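{- Let $U$ be a nonempty finite set and let $\mathcal{B}$ be a Boolean sublattice of $\mathrm{Part}(U)$ with $\triangle, \nabla \in \mathcal{B}$. Then there is a Boolean sublattice of $\mathrm{Part}(U)$ that contains $\mathcal{B}$ and has the largest size among all Boolean sublattices of $\mathrm{Part}(U)$ if and only if the hypergraph $\mathcal{H}(A(\mathcal{B}))$ is a hypertree.
   Context: $\mathrm{Part}(U)$ is the lattice of all partitions of $U$ ordered by refinement ($\pi_1\le\pi_2$ iff every block of $\pi_2$ is a union of blocks of $\pi_1$); $\triangle$ is its least element (all blocks singletons) and $\nabla$ its greatest element (single block $U$). A Boolean sublattice is a sublattice (closed under meet and join of $\mathrm{Part}(U)$) that is itself a Boolean lattice. $A(\mathcal{B})$ is the set of atoms of $\mathcal{B}$. For a set $D\subseteq \mathrm{Part}(U)\setminus\{\triangle\}$ of partitions with pairwise meet $\triangle$, $\mathcal{H}(D)$ is the hypergraph with vertex set $U$ whose edges are the non-singleton blocks of all partitions in $D$ (any two distinct edges share at most one vertex). A path is a sequence $v_0,B_1,v_1,B_2,\dots,B_n,v_n$ alternating between vertices and edges, with $v_{i-1},v_i\in B_i$, in which no vertices or edges are repeated, except that possibly $v_0=v_n$; if $v_0=v_n$ it is a cycle. Thus a cycle is a sequence $v_1,B_1,v_2,B_2,\dots,v_n,B_n,v_1$ with $n\ge 3$, $v_1\in B_1\cap B_n$, $v_i\in B_{i-1}\cap B_i$ for $2\le i\le n$, where $v_1,\dots,v_n$ are distinct vertices and $B_1,\dots,B_n$ distinct edges. A hypergraph is connected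 if any two distinct vertices are connected by a path. A hypertree is a connected hypergraph without cycles. -}

module Defs where

open import Level using (Level; _⊔_; 0ℓ) renaming (suc to lsuc)
open import Algebra.Core using (Op₁; Op₂)
open import Algebra.Lattice.Structures using (IsBooleanAlgebra)
open import Data.Empty using (⊥-elim)
open import Data.Fin.Base using (Fin; zero; suc; inject₁; fromℕ)
open import Data.Fin.Properties using (all?)
open import Data.Fin.Subset
  using (Subset; _∈_; _∉_; _⊆_; _∩_; ∁; ⁅_⁆; Nonempty) renaming (⊤ to full)
open import Data.Fin.Subset.Properties
  using ( _∈?_; ∈⊤; ⊆⊤; x∈⁅x⁆; x∈⁅y⁆⇒x≡y; ⊆-antisym; x∈p∩q⁺; x∈p∩q⁻
        ; x∈∁p⇒x∉p; x∉p⇒x∈∁p; anySubset?; _⊆?_)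
open import Data.List.Base using (List; length)
import Data.List.Membership.Setoid as Membership
import Data.List.Relation.Binary.Subset.Setoid as Sublist
import Data.List.Relation.Unary.Unique.Setoid as Uniqueness
open import Data.Nat.Base using (ℕ; suc; _≤_)
open import Data.Product.Base using (Σ; ∃; ∃-syntax; _×_; _,_; proj₁; proj₂)
open import Data.Sum.Base using (_⊎_)
open import Data.Vec.Base using (tabulate)
open import Data.Vec.Properties using (lookup∘tabulate; lookup⇒[]=; []=⇒lookup)
open import Function.Base using (_∘_; _on_)
open import Function.Definitions using (Injective)
open import Relation.Binary.Core using (Rel)
open import Relation.Binary.Lattice.Bundles using (Lattice; BoundedLattice)
open import Relation.Binary.PropositionalEquality
  using (_≡_; _≢_; refl; sym; trans; subst)
open import Relation.Nullary using (¬_; Dec; yes; no; does)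
open import Relation.Nullary.Decidable
  using (¬?; _×-dec_; _→-dec_; map′; dec-true; dec-false; decidable-stable)
open import Relation.Unary using (Pred; Decidable; _≐_)

private
  variable
    n : ℕ
    ℓ : Level

------------------------------------------------------------------------
-- Partitions of Fin n

-- A partition is its set of blocks. `Block` carries no decidability
-- assumption, since it follows from the other fields: a nonempty B is a
-- block iff it equals the block covering one of its points.

record Partition (n : ℕ) : Set₁ where
  field
    Block    : Pred (Subset n) 0ℓ
    nonempty : ∀ {B} → Block B → Nonempty B
    cover    : ∀ x → ∃[ B ] (Block B × x ∈ B)
    disjoint : ∀ {B C x} → Block B → Block C → x ∈ B → x ∈ C → B ≡ C

  block : Fin n → Subset n
  block x = proj₁ (cover x)

  block-Block : ∀ x → Block (block x)
  block-Block x = proj₁ (proj₂ (cover x))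

  x∈block : ∀ x → x ∈ block x
  x∈block x = proj₂ (proj₂ (cover x))

open Partition

UnionOfBlocks : Partition n → Pred (Subset n) 0ℓ
UnionOfBlocks π S = ∀ {x} → x ∈ S → ∃[ B ] (Block π B × x ∈ B × B ⊆ S)

infix 4 _≈ₚ_ _≤ₚ_

_≈ₚ_ : Rel (Partition n) 0ℓ
π ≈ₚ σ = Block π ≐ Block σ

_≤ₚ_ : Rel (Partition n) 0ℓ
π ≤ₚ σ = ∀ {B} → Block σ B → UnionOfBlocks π B

△ : Partition n
△ = record
  { Block    = λ B → ∃[ x ] B ≡ ⁅ x ⁆
  ; nonempty = λ { (x , refl) → x , x∈⁅x⁆ x }
  ; cover    = λ x → ⁅ x ⁆ , (x , refl) , x∈⁅x⁆ x
  ; disjoint = λ { (y , refl) (z , refl) x∈y x∈z → lemma (x∈⁅y⁆⇒x≡y y x∈y) (x∈⁅y⁆⇒x≡y z x∈z) }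
  }
  where
  lemma : ∀ {x y z : Fin n} → x ≡ y → x ≡ z → ⁅ y ⁆ ≡ ⁅ z ⁆
  lemma refl refl = refl

-- Nonemptiness only matters for n = 0, where ∇ has no block at all.
∇ : Partition n
∇ = record
  { Block    = λ B → Nonempty B × B ≡ full
  ; nonempty = proj₁
  ; cover    = λ x → full , ((x , ∈⊤) , refl) , ∈⊤
  ; disjoint = λ { (_ , refl) (_ , refl) _ _ → refl }
  }

infixr 7 _∧ₚ_
infixr 6 _∨ₚ_

_∧ₚ_ : Op₂ (Partition n)
π ∧ₚ σ = record
  { Block    = λ B → Nonempty B × ∃[ C ] ∃[ D ] (Block π C × Block σ D × B ≡ C ∩ D)
  ; nonempty = proj₁
  ; cover    = λ x →
      let x∈ = x∈p∩q⁺ (x∈block π x , x∈block σ x) in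
      block π x ∩ block σ x ,
      ((x , x∈) , block π x , block σ x , block-Block π x , block-Block σ x , refl) , x∈
  ; disjoint = λ { (_ , C , D , πC , σD , refl) (_ , C′ , D′ , πC′ , σD′ , refl) x∈ x∈′ →
      lemma (disjoint π πC πC′ (proj₁ (x∈p∩q⁻ C D x∈)) (proj₁ (x∈p∩q⁻ C′ D′ x∈′)))
            (disjoint σ σD σD′ (proj₂ (x∈p∩q⁻ C D x∈)) (proj₂ (x∈p∩q⁻ C′ D′ x∈′))) }
  }
  where
  lemma : ∀ {C D C′ D′ : Subset n} → C ≡ C′ → D ≡ D′ → C ∩ D ≡ C′ ∩ D′
  lemma refl refl = refl

-- The blocks of the join are the minimal nonempty sets that are unions of
-- blocks of both partitions.

module Join {n : ℕ} (π σ : Partition n) where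

  Saturated : Pred (Subset n) 0ℓ
  Saturated S = UnionOfBlocks π S × UnionOfBlocks σ S

  IsComponent : Pred (Subset n) 0ℓ
  IsComponent B = Nonempty B × Saturated B ×
                  (∀ {S} → Nonempty S → Saturated S → S ⊆ B → S ≡ B)

  private
    union-∩ : ∀ τ {S T : Subset n} → UnionOfBlocks τ S → UnionOfBlocks τ T →
              UnionOfBlocks τ (S ∩ T)
    union-∩ τ {S} {T} uS uT x∈ with x∈p∩q⁻ S T x∈
    ... | x∈S , x∈T with uS x∈S | uT x∈T
    ... | B , τB , x∈B , B⊆S | C , τC , x∈C , C⊆T =
      B , τB , x∈B , λ y∈B →
        x∈p∩q⁺ (B⊆S y∈B , C⊆T (subst (_ ∈_) (disjoint τ τB τC x∈B x∈C) y∈B))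

    union-∁ : ∀ τ {S : Subset n} → UnionOfBlocks τ S → UnionOfBlocks τ (∁ S)
    union-∁ τ {S} uS {x} x∈∁S =
      block τ x , block-Block τ x , x∈block τ x , λ y∈B → x∉p⇒x∈∁p λ y∈S →
        let C , τC , y∈C , C⊆S = uS y∈S in
        x∈∁p⇒x∉p x∈∁S (C⊆S (subst (x ∈_) (disjoint τ (block-Block τ x) τC y∈B y∈C) (x∈block τ x)))

    union? : ∀ τ → Decidable (UnionOfBlocks {n} τ)
    union? τ S = map′
      (λ f {x} x∈S → block τ x , block-Block τ x , x∈block τ x , λ {y} → f x x∈S {y})
      (λ u x x∈S {_} y∈ → let B , τB , x∈B , B⊆S = u x∈S in
        B⊆S (subst (_ ∈_) (disjoint τ (block-Block τ x) τB (x∈block τ x) x∈B) y∈))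
      (all? λ x → (x ∈? S) →-dec (block τ x ⊆? S))

    saturated-∩ : ∀ {S T} → Saturated S → Saturated T → Saturated (S ∩ T)
    saturated-∩ (p , s) (p′ , s′) = union-∩ π p p′ , union-∩ σ s s′

    saturated-∁ : ∀ {S} → Saturated S → Saturated (∁ S)
    saturated-∁ (p , s) = union-∁ π p , union-∁ σ s

    Separates : Fin n → Fin n → Pred (Subset n) 0ℓ
    Separates x y S = Saturated S × x ∈ S × y ∉ S

    separated? : ∀ x y → Dec (∃ (Separates x y))
    separated? x y = anySubset? λ S →
      (union? π S ×-dec union? σ S) ×-dec (x ∈? S) ×-dec ¬? (y ∈? S)

  component : Fin n → Subset n
  component x = tabulate (λ y → does (¬? (separated? x y)))

  private
    component⁺ : ∀ {x y} → ¬ ∃ (Separates x y) → y ∈ component x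
    component⁺ {x} {y} ¬s =
      lookup⇒[]= y _ (trans (lookup∘tabulate _ y) (dec-true (¬? (separated? x y)) ¬s))

    component⁻ : ∀ {x y} → y ∈ component x → ¬ ∃ (Separates x y)
    component⁻ {x} {y} y∈ s
      with () ← trans (sym (dec-false (¬? (separated? x y)) (λ ¬s → ¬s s)))
                      (trans (sym (lookup∘tabulate _ y)) ([]=⇒lookup y∈))

  x∈component : ∀ x → x ∈ component x
  x∈component x = component⁺ λ { (_ , _ , x∈ , x∉) → x∉ x∈ }

  component-least : ∀ {x S} → Saturated S → x ∈ S → component x ⊆ S
  component-least {S = S} sS x∈S {y} y∈ =
    decidable-stable (y ∈? S) λ y∉S → component⁻ y∈ (S , sS , x∈S , y∉S)

  private
    union-component : ∀ τ x → (∀ {S} → Saturated S → UnionOfBlocks τ S) →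
                      UnionOfBlocks τ (component x)
    union-component τ x sat⇒union {y} y∈ =
      block τ y , block-Block τ y , x∈block τ y , λ z∈ → component⁺
        λ { (S , sS , x∈S , z∉S) →
          let B , τB , y∈B , B⊆S = sat⇒union sS (component-least sS x∈S y∈) in
          z∉S (B⊆S (subst (_ ∈_) (disjoint τ (block-Block τ y) τB (x∈block τ y) y∈B) z∈)) }

  component-saturated : ∀ x → Saturated (component x)
  component-saturated x = union-component π x proj₁ , union-component σ x proj₂

  component-IsComponent : ∀ x → IsComponent (component x)
  component-IsComponent x = (x , x∈component x) , component-saturated x , minimal
    where
    minimal : ∀ {S} → Nonempty S → Saturated S → S ⊆ component x → S ≡ component x
    minimal {S} (y , y∈S) sS S⊆ with x ∈? S
    ... | yes x∈S = ⊆-antisym S⊆ (component-least sS x∈S)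
    ... | no  x∉S = ⊥-elim
      (x∈∁p⇒x∉p (component-least (saturated-∁ sS) (x∉p⇒x∈∁p x∉S) (S⊆ y∈S)) y∈S)

  join : Partition n
  join = record
    { Block    = IsComponent
    ; nonempty = proj₁
    ; cover    = λ x → component x , component-IsComponent x , x∈component x
    ; disjoint = λ {B} {C} {x} (_ , sB , minB) (_ , sC , minC) x∈B x∈C →
        let x∈ = x , x∈p∩q⁺ (x∈B , x∈C)
            s  = saturated-∩ sB sC
        in trans (sym (minB x∈ s (proj₁ ∘ x∈p∩q⁻ B C)))
                 (minC x∈ s (proj₂ ∘ x∈p∩q⁻ B C))
    }

_∨ₚ_ : Op₂ (Partition n)
_∨ₚ_ = Join.join

------------------------------------------------------------------------
-- The lattice Part(Fin n)

private
  ≤ₚ-reflexive : {π σ : Partition n} → π ≈ₚ σ → π ≤ₚ σ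
  ≤ₚ-reflexive (_ , σ⊆π) {B} σB x∈B = B , σ⊆π σB , x∈B , λ y∈B → y∈B

  ≤ₚ-trans : {π σ τ : Partition n} → π ≤ₚ σ → σ ≤ₚ τ → π ≤ₚ τ
  ≤ₚ-trans π≤σ σ≤τ τB x∈B =
    let C , σC , x∈C , C⊆B = σ≤τ τB x∈B
        D , πD , x∈D , D⊆C = π≤σ σC x∈C
    in D , πD , x∈D , C⊆B ∘ D⊆C

  ≤ₚ-antisym-⊆ : {π σ : Partition n} → π ≤ₚ σ → σ ≤ₚ π →
                 ∀ {B} → Block π B → Block σ B
  ≤ₚ-antisym-⊆ {π = π} {σ} π≤σ σ≤π πB =
    let x , x∈B            = nonempty π πB
        C , σC , x∈C , C⊆B = σ≤π πB x∈B
        D , πD , x∈D , D⊆C = π≤σ σC x∈C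
        B≡D                = disjoint π πB πD x∈B x∈D
    in subst (Block σ) (⊆-antisym C⊆B (λ y∈B → D⊆C (subst (_ ∈_) B≡D y∈B))) σC

  ∧ₚ-lowerˡ : (π σ : Partition n) → π ∧ₚ σ ≤ₚ π
  ∧ₚ-lowerˡ π σ {B} πB {x} x∈B =
    let x∈ = x∈p∩q⁺ (x∈B , x∈block σ x) in
    B ∩ block σ x , ((x , x∈) , B , block σ x , πB , block-Block σ x , refl) , x∈ ,
    (proj₁ ∘ x∈p∩q⁻ B (block σ x))

  ∧ₚ-lowerʳ : (π σ : Partition n) → π ∧ₚ σ ≤ₚ σ
  ∧ₚ-lowerʳ π σ {B} σB {x} x∈B =
    let x∈ = x∈p∩q⁺ (x∈block π x , x∈B) in
    block π x ∩ B , ((x , x∈) , block π x , B , block-Block π x , σB , refl) , x∈ ,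
    (proj₂ ∘ x∈p∩q⁻ (block π x) B)

  ∧ₚ-greatest : (π σ τ : Partition n) → τ ≤ₚ π → τ ≤ₚ σ → τ ≤ₚ π ∧ₚ σ
  ∧ₚ-greatest π σ τ τ≤π τ≤σ (_ , C , D , πC , σD , refl) x∈ =
    let x∈C , x∈D           = x∈p∩q⁻ C D x∈
        E , τE , x∈E , E⊆C  = τ≤π πC x∈C
        F , τF , x∈F , F⊆D  = τ≤σ σD x∈D
        E≡F                 = disjoint τ τE τF x∈E x∈F
    in E , τE , x∈E , λ y∈E → x∈p∩q⁺ (E⊆C y∈E , F⊆D (subst (_ ∈_) E≡F y∈E))

  ∨ₚ-least : (π σ τ : Partition n) → π ≤ₚ τ → σ ≤ₚ τ → π ∨ₚ σ ≤ₚ τ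
  ∨ₚ-least π σ τ π≤τ σ≤τ τB {x} x∈B =
    component x , component-IsComponent x , x∈component x ,
    component-least (π≤τ τB , σ≤τ τB) x∈B
    where open Join π σ

Part : ℕ → BoundedLattice (lsuc 0ℓ) 0ℓ 0ℓ
Part n = record
  { Carrier = Partition n
  ; _≈_ = _≈ₚ_
  ; _≤_ = _≤ₚ_
  ; _∨_ = _∨ₚ_
  ; _∧_ = _∧ₚ_
  ; ⊤ = ∇
  ; ⊥ = △
  ; isBoundedLattice = record
    { isLattice = record
      { isPartialOrder = record
        { isPreorder = record
          { isEquivalence = record
            { refl  = (λ b → b) , (λ b → b)
            ; sym   = λ (f , g) → g , f
            ; trans = λ (f , g) (h , k) → (λ b → h (f b)) , (λ b → g (k b))
            }
          ; reflexive = λ {π} {σ} → ≤ₚ-reflexive {π = π} {σ}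
          ; trans     = λ {π} {σ} {τ} → ≤ₚ-trans {π = π} {σ} {τ}
          }
        ; antisym = λ {π} {σ} p q →
            ≤ₚ-antisym-⊆ {π = π} {σ} p q , ≤ₚ-antisym-⊆ {π = σ} {π} q p
        }
      ; supremum = λ π σ → (λ (_ , (p , _) , _) → p) , (λ (_ , (_ , s) , _) → s) , ∨ₚ-least π σ
      ; infimum  = λ π σ → ∧ₚ-lowerˡ π σ , ∧ₚ-lowerʳ π σ , ∧ₚ-greatest π σ
      }
    ; maximum = λ { π (_ , refl) {x} _ → block π x , block-Block π x , x∈block π x , ⊆⊤ }
    ; minimum = λ π {B} _ {x} x∈B →
        ⁅ x ⁆ , (x , refl) , x∈⁅x⁆ x ,
        λ y∈ → subst (_∈ B) (sym (x∈⁅y⁆⇒x≡y x y∈)) x∈B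
    }
  }

------------------------------------------------------------------------
-- Finite Boolean sublattices

-- The underlying set is a list without repetitions (up to _≈_), so its size
-- is the length of the list.

record Sublattice {c ℓ₁ ℓ₂} (L : Lattice c ℓ₁ ℓ₂) : Set (c ⊔ ℓ₁) where
  open Lattice L using (Carrier; _∨_; _∧_; setoid)
  open Membership setoid using () renaming (_∈_ to _∈ₗ_)
  field
    elements : List Carrier
    unique   : Uniqueness.Unique setoid elements
    ∨-closed : ∀ {x y} → x ∈ₗ elements → y ∈ₗ elements → x ∨ y ∈ₗ elements
    ∧-closed : ∀ {x y} → x ∈ₗ elements → y ∈ₗ elements → x ∧ y ∈ₗ elements

  Element : Set (c ⊔ ℓ₁)
  Element = Σ Carrier (_∈ₗ elements)

  _∨ˢ_ _∧ˢ_ : Op₂ Element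
  (x , x∈) ∨ˢ (y , y∈) = x ∨ y , ∨-closed x∈ y∈
  (x , x∈) ∧ˢ (y , y∈) = x ∧ y , ∧-closed x∈ y∈

  size : ℕ
  size = length elements

-- The bounds and the complement are those of the sublattice itself; the bounds
-- need not be bounds of the ambient lattice.

record BooleanSublattice {c ℓ₁ ℓ₂} (L : Lattice c ℓ₁ ℓ₂) : Set (c ⊔ ℓ₁) where
  open Lattice L using (_≈_)
  field
    sublattice : Sublattice L

  open Sublattice sublattice public

  field
    ∁ˢ               : Op₁ Element
    ⊤ˢ ⊥ˢ            : Element
    isBooleanAlgebra : IsBooleanAlgebra (_≈_ on proj₁) _∨ˢ_ _∧ˢ_ ∁ˢ ⊤ˢ ⊥ˢ

module _ {c ℓ₁ ℓ₂} {L : Lattice c ℓ₁ ℓ₂} where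
  open Lattice L using (Carrier; _≈_; setoid) renaming (_≤_ to _≼_)
  open BooleanSublattice

  infix 4 _∈ˢ_ _⊆ˢ_

  _∈ˢ_ : Carrier → BooleanSublattice L → Set (c ⊔ ℓ₁)
  x ∈ˢ S = Membership._∈_ setoid x (elements S)

  _⊆ˢ_ : Rel (BooleanSublattice L) (c ⊔ ℓ₁)
  S ⊆ˢ T = Sublist._⊆_ setoid (elements S) (elements T)

  Atoms : BooleanSublattice L → Pred Carrier (c ⊔ ℓ₁ ⊔ ℓ₂)
  Atoms S a = a ∈ˢ S × ¬ a ≈ proj₁ (⊥ˢ S) ×
              (∀ {x} → x ∈ˢ S → x ≼ a → x ≈ proj₁ (⊥ˢ S) ⊎ x ≈ a)

PartSublattice : ℕ → Set₁
PartSublattice n = BooleanSublattice (BoundedLattice.lattice (Part n))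

Largest : PartSublattice n → Set₁
Largest {n} S = ∀ (T : PartSublattice n) → BooleanSublattice.size T ≤ BooleanSublattice.size S

------------------------------------------------------------------------
-- Hypergraphs

record Hypergraph (n : ℕ) (ℓ : Level) : Set (lsuc ℓ) where
  field
    Edge : Pred (Subset n) ℓ

open Hypergraph

-- The construction makes sense for every set D of partitions. Distinct edges
-- share at most one vertex when the members of D have pairwise meet △, as the
-- atoms of a Boolean sublattice containing △ do.

𝓗 : Pred (Partition n) ℓ → Hypergraph n (lsuc 0ℓ ⊔ ℓ)
Edge (𝓗 D) B = (∀ x → B ≢ ⁅ x ⁆) × ∃[ π ] (D π × Block π B)

-- edge i joins vertex i to vertex i + 1, for 0 ≤ i < len. The only repetition
-- allowed is that the first vertex may equal the last.

record Path {n : ℕ} (H : Hypergraph n ℓ) (len : ℕ) : Set ℓ where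
  field
    vertex          : Fin (suc len) → Fin n
    edge            : Fin len → Subset n
    isEdge          : ∀ i → Edge H (edge i)
    source∈         : ∀ i → vertex (inject₁ i) ∈ edge i
    target∈         : ∀ i → vertex (suc i) ∈ edge i
    edges-distinct  : Injective _≡_ _≡_ edge
    vertex-repeated : ∀ {i j} → vertex i ≡ vertex j →
                      i ≡ j ⊎ (i ≡ zero × j ≡ fromℕ len) ⊎ (i ≡ fromℕ len × j ≡ zero)

  source target : Fin n
  source = vertex zero
  target = vertex (fromℕ len)

open Path using (source; target)

Cycle : Hypergraph n ℓ → Set ℓ
Cycle H = ∃[ len ] (3 ≤ len × ∃[ p ] source {H = H} {len} p ≡ target p)

Connected : Hypergraph n ℓ → Set ℓ
Connected {n} H = ∀ {x y : Fin n} → x ≢ y →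
  ∃[ len ] ∃[ p ] (source {H = H} {len} p ≡ x × target p ≡ y)

IsHypertree : Hypergraph n ℓ → Set ℓ
IsHypertree H = Connected H × ¬ Cycle H

{-# OPTIONS --safe #-}
module Submission where

-- Write n = m + 1. The number of points that are not minimal in their block is a strictly
-- monotone rank on Part(U), bounded by m. Joining an atom to y at most halves the number of elements
-- above y, so a Boolean sublattice has at most 2^m elements, and in case of equality every atom has
-- rank 1, i.e. has a single non-singleton block, which is a pair.
--
-- Cutting edges of a rooted spanning tree gives Boolean sublattices with exactly 2^m elements. If
-- 𝓗(A(𝓑)) is a hypertree, root it at 0; every hyperedge B has a vertex r nearest to the root, and the
-- tree in which the other vertices of B are children of r has each atom of 𝓑 as a subforest.
--
-- Conversely, let 𝓒 ⊇ 𝓑 be largest and let B₀, B₁, … be the hyperedges of a cycle. The atoms of 𝓒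
-- inside a hyperedge connect it. Let p be the greatest element of 𝓒 that is trivial outside B₀. Then
-- p connects the two cycle vertices of B₀, and so does the complement of p, along B₁, B₂, …;
-- but p and its complement meet in △.

open import Defs
open import Algebra.Lattice.Bundles using (BooleanAlgebra)
open import Algebra.Lattice.Structures using (IsLattice; IsBooleanAlgebra)
open import Data.Bool.Base using (true; false)
import Data.Bool.Properties as Bool
open import Data.Empty using (⊥-elim)
open import Data.Fin.Base using (Fin; zero; suc; inject₁; fromℕ)
import Data.Fin.Base as Fin
import Data.Fin.Induction as Fin
open import Data.Fin.Properties using (any?; all?; _≟_)
import Data.Fin.Properties as Fin
open import Data.Fin.Subset
  using (Subset; _∈_; _∉_; _⊆_; _⊂_; _∪_; _∩_; ∁; ⁅_⁆; ∣_∣) renaming (⊤ to full; ⊥ to none)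
open import Data.Fin.Subset.Properties
  using ( _∈?_; ∈⊤; x∈⁅x⁆; x∈⁅y⁆⇒x≡y; x∈p∩q⁺; x∈p∪q⁺; x∈p∪q⁻; p⊆p∪q; q⊆p∪q; p∩q⊆p; p∩q⊆q
        ; ⊆-antisym; nonempty?; Empty-unique; ∣p∣≤n; p⊆q⇒∣p∣≤∣q∣; p⊂q⇒∣p∣<∣q∣; x∈p⇒∣p-x∣<∣p∣
        ; x∈p∧x≢y⇒x∈p-y; ∪-∩-booleanAlgebra)
import Data.Fin.Subset.Properties as Subset
open import Data.List.Base
  using (List; []; _∷_; length; lookup; map; filter; cartesianProductWith)
open import Data.List.Membership.Propositional using () renaming (_∈_ to _∈ₗ_)
open import Data.List.Membership.Propositional.Properties using (∈-lookup; ∈-cartesianProductWith⁺)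
import Data.List.Membership.Setoid as Membership
open import Data.List.Properties using (length-map; length-++)
open import Data.List.Relation.Unary.All as All using (All; []; _∷_)
import Data.List.Relation.Unary.All.Properties as All
open import Data.List.Relation.Unary.AllPairs using ([]; _∷_)
open import Data.List.Relation.Unary.Any as Any using (here; there)
import Data.List.Relation.Unary.Any.Properties as Any
import Data.List.Relation.Unary.Unique.Propositional.Properties as Unique≡
import Data.List.Relation.Unary.Unique.Setoid as Uniqueness
import Data.List.Relation.Unary.Unique.Setoid.Properties as Unique
open import Data.Nat.Base using (ℕ; zero; suc; _+_; _∸_; _^_; z≤n; s≤s; NonZero; ≢-nonZero⁻¹)
import Data.Nat.Base as ℕ
open import Data.Nat.Induction using (Acc; acc; <-wellFounded)
import Data.Nat.Properties as ℕ
open import Data.Product.Base using (Σ-syntax; ∃; ∃-syntax; _×_; _,_; proj₁; proj₂)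
open import Data.Sum.Base using (_⊎_; inj₁; inj₂; [_,_]′)
open import Data.Vec.Base using (tabulate)
import Data.Vec.Base as Vec
open import Data.Vec.Properties using (lookup∘tabulate; lookup⇒[]=; []=⇒lookup)
import Data.Vec.Properties as Vec
open import Function.Base using (_∘_)
open import Function.Bundles using (_⇔_; mk⇔)
open import Function.Definitions using (Injective)
open import Level using (Level; 0ℓ; _⊔_)
open import Relation.Binary.Construct.Closure.ReflexiveTransitive
  using (Star; ε; _◅_; _◅◅_; fold; reverse)
open import Relation.Binary.Core using (Rel; _⇒_)
import Relation.Binary.Definitions as Binary
open import Relation.Binary.Definitions using (Reflexive; Transitive; tri<; tri≈; tri>)
open import Relation.Binary.Lattice.Bundles using (Lattice; BoundedLattice)
import Relation.Binary.Lattice.Properties.Lattice as Latticeₚ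
open import Relation.Binary.PropositionalEquality
  using (_≡_; _≢_; refl; sym; trans; cong; cong₂; subst)
import Relation.Binary.PropositionalEquality as ≡
import Relation.Binary.Reasoning.PartialOrder as PosetReasoning
open import Relation.Binary.Structures using (IsEquivalence)
open import Relation.Nullary using (¬_; yes; no; does; contradiction)
open import Relation.Nullary.Decidable
  using (¬?; _×-dec_; _→-dec_; _⊎-dec_; map′; dec-true)
open import Relation.Unary using (Pred)
import Relation.Unary as Unary

open Hypergraph using (Edge)
open Partition
open Path hiding (source; target)

private
  variable
    n : ℕ
    ℓ : Level
    x y z : Fin n
    B : Subset n
    us vs : List (Fin n)

-- Boolean sublattices of ranked lattices

length-filter-¬ : ∀ {a p} {A : Set a} {P : Pred A p} (P? : Unary.Decidable P) xs →
                  length xs ≡ length (filter P? xs) + length (filter (¬? ∘ P?) xs)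
length-filter-¬ P? [] = refl
length-filter-¬ P? (x ∷ xs) with P? x
... | yes _ = cong suc (length-filter-¬ P? xs)
... | no  _ = trans (cong suc (length-filter-¬ P? xs)) (sym (ℕ.+-suc _ _))

module _ {c ℓ₁ ℓ₂} (L : Lattice c ℓ₁ ℓ₂) where

  open Lattice L using
    ( Carrier; _≈_; _≤_; _∨_; _∧_; module Eq; antisym; reflexive; setoid; poset
    ; x≤x∨y; y≤x∨y; ∨-least; x∧y≤x; x∧y≤y; ∧-greatest)
    renaming (refl to ≤-refl; trans to ≤-trans)

  module BooleanSublatticeProperties
    (_≤?_ : Binary.Decidable _≤_) (rank : Carrier → ℕ)
    (rank-mono : ∀ x y → x ≤ y → rank x ℕ.≤ rank y)
    (rank-strict : ∀ x y → x ≤ y → ¬ y ≤ x → rank x ℕ.< rank y)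
    {m : ℕ} (rank-bounded : ∀ x → rank x ℕ.≤ m)
    where

    open Uniqueness setoid using (Unique)
    open Membership setoid using (find) renaming (_∈_ to _∈ˡ_)

    -- Nonemptiness is supplied separately at each use, as `Q ⊥` for the bottom of the sublattice.
    record IsIdeal {q} (Q : Pred Carrier q) : Set (c ⊔ ℓ₂ ⊔ q) where
      field
        downward : ∀ {x y} → x ≤ y → Q y → Q x
        directed : ∀ {x y} → Q x → Q y → Q (x ∨ y)

    open IsIdeal

    -- Injectivity is relative to `P` because the intended map, joining with an atom `a`, is
    -- injective on the elements not above `a` but not on all elements.
    unique-map : ∀ {p} {P : Pred Carrier p} {f : Carrier → Carrier} →
                 (∀ {x y} → P x → P y → f x ≈ f y → x ≈ y) →
                 ∀ {xs} → All P xs → Unique xs → Unique (map f xs)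
    unique-map inj [] [] = []
    unique-map inj (px ∷ pxs) (x∉ ∷ xs!) =
      All.map⁺ (All.zipWith (λ (x≉y , py) → x≉y ∘ inj px py) (x∉ , pxs)) ∷ unique-map inj pxs xs!

    module _ (S : BooleanSublattice L) where
      open BooleanSublattice S
      open IsBooleanAlgebra isBooleanAlgebra
        using (∨-complementʳ; ∧-complementʳ; ∧-distribˡ-∨; ∧-distribʳ-∨)
      open PosetReasoning poset

      ⊤ ⊥ : Carrier
      ⊤ = proj₁ ⊤ˢ
      ⊥ = proj₁ ⊥ˢ

      x≤⊤ : (x : Element) → proj₁ x ≤ ⊤
      x≤⊤ x = ≤-trans (x≤x∨y _ _) (reflexive (∨-complementʳ x))

      ⊥≤x : (x : Element) → ⊥ ≤ proj₁ x
      ⊥≤x x = ≤-trans (reflexive (Eq.sym (∧-complementʳ x))) (x∧y≤x _ _)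

      -- Distributivity splits `x` into its parts below `y` and below `∁ˢ y`; the bound `z` ranges
      -- over the whole ambient lattice.
      by-cases : ∀ (x y : Element) {z} → proj₁ x ∧ proj₁ y ≤ z → proj₁ x ∧ proj₁ (∁ˢ y) ≤ z →
                 proj₁ x ≤ z
      by-cases x y {z} p q = begin
        proj₁ x                                            ≤⟨ ∧-greatest ≤-refl x≤y∨∁y ⟩
        proj₁ x ∧ (proj₁ y ∨ proj₁ (∁ˢ y))                 ≈⟨ ∧-distribˡ-∨ x y (∁ˢ y) ⟩
        (proj₁ x ∧ proj₁ y) ∨ (proj₁ x ∧ proj₁ (∁ˢ y))     ≤⟨ ∨-least p q ⟩
        z                                                  ∎
        where x≤y∨∁y = ≤-trans (x≤⊤ x) (reflexive (Eq.sym (∨-complementʳ y)))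

      -- Split `x` along `a`: the part below `a` is bottom, and the part below `∁ˢ a` lies below
      -- `(y ∨ a) ∧ ∁a`, hence below `y`.
      ∨-cancelʳ : ∀ (a x y : Element) → proj₁ x ∧ proj₁ a ≤ ⊥ →
                  proj₁ x ∨ proj₁ a ≤ proj₁ y ∨ proj₁ a → proj₁ x ≤ proj₁ y
      ∨-cancelʳ a x y x∧a≤⊥ x∨a≤y∨a = by-cases x a (≤-trans x∧a≤⊥ (⊥≤x y)) (begin
        proj₁ x ∧ ∁a                       ≤⟨ ∧-greatest (≤-trans (x∧y≤x _ _) x≤y∨a) (x∧y≤y _ _) ⟩
        (proj₁ y ∨ proj₁ a) ∧ ∁a           ≈⟨ ∧-distribʳ-∨ (∁ˢ a) y a ⟩
        (proj₁ y ∧ ∁a) ∨ (proj₁ a ∧ ∁a)    ≤⟨ ∨-least (x∧y≤x _ _) a∧∁a≤y ⟩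
        proj₁ y                            ∎)
        where
        ∁a     = proj₁ (∁ˢ a)
        x≤y∨a  = ≤-trans (x≤x∨y _ _) x∨a≤y∨a
        a∧∁a≤y = ≤-trans (reflexive (∧-complementʳ a)) (⊥≤x y)

      ¬atom≤⊥ : ∀ {a} → Atoms S a → ¬ a ≤ ⊥
      ¬atom≤⊥ (a∈ , a≉⊥ , _) a≤⊥ = a≉⊥ (antisym a≤⊥ (⊥≤x (_ , a∈)))

      atom≤⊎∧≤⊥ : ∀ {a} → Atoms S a → (x : Element) → a ≤ proj₁ x ⊎ proj₁ x ∧ a ≤ ⊥
      atom≤⊎∧≤⊥ (a∈ , _ , min) x with min (∧-closed (proj₂ x) a∈) (x∧y≤y _ _)
      ... | inj₁ x∧a≈⊥ = inj₂ (reflexive x∧a≈⊥)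
      ... | inj₂ x∧a≈a = inj₁ (≤-trans (reflexive (Eq.sym x∧a≈a)) (x∧y≤x _ _))

      atom≤⊎≤∁ : ∀ {a} → Atoms S a → (x : Element) → a ≤ proj₁ x ⊎ a ≤ proj₁ (∁ˢ x)
      atom≤⊎≤∁ {a} atom x with atom≤⊎∧≤⊥ atom x
      ... | inj₁ a≤x   = inj₁ a≤x
      ... | inj₂ x∧a≤⊥ = inj₂ (by-cases (a , proj₁ atom) x
        (≤-trans (∧-greatest (x∧y≤y _ _) (x∧y≤x _ _)) (≤-trans x∧a≤⊥ (⊥≤x (∁ˢ x)))) (x∧y≤y _ _))

      -- Descent on `rank`: either `elements` has a member strictly between bottom and `b`, or `b`
      -- is itself an atom.
      atom-below : (b : Element) → ¬ proj₁ b ≤ ⊥ → ∃[ a ] (Atoms S a × a ≤ proj₁ b)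
      atom-below b = go b (<-wellFounded _)
        where
        go : (b : Element) → Acc ℕ._<_ (rank (proj₁ b)) → ¬ proj₁ b ≤ ⊥ →
             ∃[ a ] (Atoms S a × a ≤ proj₁ b)
        go (b , b∈) (acc rs) b≰⊥
          with Any.any? (λ x → (x ≤? b) ×-dec ¬? (b ≤? x) ×-dec ¬? (x ≤? ⊥)) elements
        ... | yes p = let x , x∈ , x≤b , b≰x , x≰⊥ = find p
                          a , atom , a≤x = go (x , x∈) (rs (rank-strict _ _ x≤b b≰x)) x≰⊥
                      in a , atom , ≤-trans a≤x x≤b
        ... | no ¬p = b , (b∈ , (b≰⊥ ∘ reflexive) , minimal) , ≤-refl
          where
          minimal : ∀ {x} → x ∈ˡ elements → x ≤ b → x ≈ ⊥ ⊎ x ≈ b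
          minimal {x} x∈ x≤b with x ≤? ⊥ | b ≤? x
          ... | yes x≤⊥ | _       = inj₁ (antisym x≤⊥ (⊥≤x (x , x∈)))
          ... | _       | yes b≤x = inj₂ (antisym x≤b b≤x)
          -- The search tested list entries, whereas `x` is only equivalent to one, so the three
          -- conditions are carried along `x ≈ y`.
          ... | no x≰⊥  | no b≰x  = contradiction (Any.map (λ x≈y →
            ≤-trans (reflexive (Eq.sym x≈y)) x≤b ,
            (λ b≤y → b≰x (≤-trans b≤y (reflexive (Eq.sym x≈y)))) ,
            (λ y≤⊥ → x≰⊥ (≤-trans (reflexive x≈y) y≤⊥))) x∈) ¬p

      -- Induction on `rank`: for an atom `a ≤ b`, the element `b ∧ ∁ a` has smaller rank, and `b`
      -- lies below its join with `a`.
      atoms-generate : ∀ {q} {Q : Pred Carrier q} → IsIdeal Q → Q ⊥ → (b : Element) →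
                       (∀ {a} → Atoms S a → a ≤ proj₁ b → Q a) → Q (proj₁ b)
      atoms-generate {Q = Q} ideal Q⊥ b = go b (<-wellFounded _)
        where
        go : (b : Element) → Acc ℕ._<_ (rank (proj₁ b)) →
             (∀ {a} → Atoms S a → a ≤ proj₁ b → Q a) → Q (proj₁ b)
        go b (acc rs) Qatoms with proj₁ b ≤? ⊥
        ... | yes b≤⊥ = downward ideal b≤⊥ Q⊥
        ... | no  b≰⊥ with a , atom , a≤b ← atom-below b b≰⊥ =
          downward ideal
            (by-cases b aˢ (≤-trans (x∧y≤y _ _) (x≤x∨y _ _)) (y≤x∨y _ _))
            (directed ideal (Qatoms atom a≤b)
              (go b′ (rs (rank-strict _ _ b′≤b b≰b′)) λ atom′ a′≤b′ → Qatoms atom′ (≤-trans a′≤b′ b′≤b)))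
          where
          aˢ = a , proj₁ atom
          b′ = b ∧ˢ ∁ˢ aˢ

          b′≤b : proj₁ b′ ≤ proj₁ b
          b′≤b = x∧y≤x _ _

          b≰b′ : ¬ proj₁ b ≤ proj₁ b′
          b≰b′ b≤b′ = ¬atom≤⊥ atom (≤-trans
            (∧-greatest ≤-refl (≤-trans a≤b (≤-trans b≤b′ (x∧y≤y _ _))))
            (reflexive (∧-complementʳ aˢ)))

      -- The greatest element is the join of all list entries that satisfy `Q`.
      principal : ∀ {q} {Q : Pred Carrier q} → IsIdeal Q → Unary.Decidable Q → Q ⊥ →
                  Σ[ p ∈ Element ] (Q (proj₁ p) × ((x : Element) → Q (proj₁ x) → proj₁ x ≤ proj₁ p))
      principal {Q = Q} ideal Q? Q⊥ =
        let p , Qp , ub = go elements (λ x∈ → x∈)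
        in p , Qp , λ (x , x∈) Qx →
             let y , y∈ , x≈y , y≤p = find′ x∈ ub
             in ≤-trans (reflexive x≈y) (y≤p (downward ideal (reflexive (Eq.sym x≈y)) Qx))
        where
        go : ∀ xs → (∀ {x} → x ∈ˡ xs → x ∈ˡ elements) →
             Σ[ p ∈ Element ] (Q (proj₁ p) × All (λ x → Q x → x ≤ proj₁ p) xs)
        go []       _   = ⊥ˢ , Q⊥ , []
        go (x ∷ xs) sub with Q? x | go xs (sub ∘ there)
        ... | yes Qx | p , Qp , ub = (x , sub (here Eq.refl)) ∨ˢ p , directed ideal Qx Qp ,
          (λ _ → x≤x∨y _ _) ∷ All.map (λ f Qy → ≤-trans (f Qy) (y≤x∨y _ _)) ub
        ... | no ¬Qx | p , Qp , ub = p , Qp , (λ Qx → contradiction Qx ¬Qx) ∷ ub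

        find′ : ∀ {p x xs} {P : Pred Carrier p} → x ∈ˡ xs → All P xs → ∃[ y ] (y ∈ˡ xs × x ≈ y × P y)
        find′ (here x≈y) (py ∷ _)  = _ , here Eq.refl , x≈y , py
        find′ (there x∈) (_ ∷ pys) = let y , y∈ , r = find′ x∈ pys in y , there y∈ , r

      -- Counting quantifies over duplicate-free lists, so that it applies to filtered lists and to
      -- their images under `_∨ a`.
      AtMostAbove : ℕ → Carrier → Set _
      AtMostAbove k y = ∀ xs → Unique xs → All (λ x → x ∈ˡ elements × y ≤ x) xs → length xs ℕ.≤ k

      -- Elements above y that do not lie above a are sent injectively by (_∨ a) to elements
      -- above y ∨ a.
      atMostAbove-double : ∀ {k a y} → Atoms S a → AtMostAbove k (y ∨ a) → AtMostAbove (k + k) y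
      atMostAbove-double {k} {a} {y} atom few xs xs! above = ℕ.≤-trans
        (ℕ.≤-reflexive (length-filter-¬ (a ≤?_) xs))
        (ℕ.+-mono-≤
          (few _ (Unique.filter⁺ setoid (a ≤?_) xs!)
            (All.zipWith (λ (a≤x , x∈ , y≤x) → x∈ , ∨-least y≤x a≤x)
              (All.all-filter (a ≤?_) xs , All.filter⁺ (a ≤?_) above)))
          (ℕ.≤-trans (ℕ.≤-reflexive (sym (length-map (_∨ a) rest)))
            (few _
              (unique-map
                (λ { {x} {x′} (a≰x , x∈ , _) (a≰x′ , x′∈ , _) eq → antisym
                       (cancel (x , x∈) (x′ , x′∈) a≰x (reflexive eq))
                       (cancel (x′ , x′∈) (x , x∈) a≰x′ (reflexive (Eq.sym eq))) })
                rest-above (Unique.filter⁺ setoid (¬? ∘ (a ≤?_)) xs!))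
              (All.map⁺ (All.map (λ (_ , x∈ , y≤x) →
                ∨-closed x∈ (proj₁ atom) , ∨-least (≤-trans y≤x (x≤x∨y _ _)) (y≤x∨y _ _)) rest-above)))))
        where
        rest = filter (¬? ∘ (a ≤?_)) xs

        rest-above : All (λ x → ¬ a ≤ x × x ∈ˡ elements × y ≤ x) rest
        rest-above = All.zipWith (λ p → p)
          (All.all-filter (¬? ∘ (a ≤?_)) xs , All.filter⁺ (¬? ∘ (a ≤?_)) above)

        cancel : (x x′ : Element) → ¬ a ≤ proj₁ x → proj₁ x ∨ a ≤ proj₁ x′ ∨ a → proj₁ x ≤ proj₁ x′
        cancel x x′ a≰x with atom≤⊎∧≤⊥ atom x
        ... | inj₁ a≤x   = contradiction a≤x a≰x
        ... | inj₂ x∧a≤⊥ = ∨-cancelʳ (a , proj₁ atom) x x′ x∧a≤⊥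

      -- Induction on the exponent. If `∁ˢ y` is bottom, then `y` is the top and only one element
      -- lies above it. Otherwise an atom below `∁ˢ y` is joined to `y`, which raises the rank, and
      -- `atMostAbove-double` applies.
      atMostAbove-rank : (y : Element) → AtMostAbove (2 ^ (m ∸ rank (proj₁ y))) (proj₁ y)
      atMostAbove-rank y = go y (<-wellFounded _)
        where
        go : (y : Element) → Acc ℕ._<_ (m ∸ rank (proj₁ y)) →
             AtMostAbove (2 ^ (m ∸ rank (proj₁ y))) (proj₁ y)
        go y (acc rs) xs xs! above with proj₁ (∁ˢ y) ≤? ⊥
        ... | yes ∁y≤⊥ = ℕ.≤-trans (subsingleton xs xs! above) (ℕ.m^n>0 2 (m ∸ rank (proj₁ y)))
          where
          ⊤≤y : ⊤ ≤ proj₁ y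
          ⊤≤y = by-cases ⊤ˢ y (x∧y≤y _ _) (≤-trans (x∧y≤y _ _) (≤-trans ∁y≤⊥ (⊥≤x y)))

          subsingleton : ∀ xs → Unique xs → All (λ x → x ∈ˡ elements × proj₁ y ≤ x) xs → length xs ℕ.≤ 1
          subsingleton []           _                  _ = z≤n
          subsingleton (_ ∷ [])     _                  _ = s≤s z≤n
          subsingleton (_ ∷ _ ∷ _) ((x≉x′ ∷ _) ∷ _) ((x∈ , y≤x) ∷ (x′∈ , y≤x′) ∷ _) =
            contradiction (antisym (≤-trans (x≤⊤ (_ , x∈)) (≤-trans ⊤≤y y≤x′))
                                   (≤-trans (x≤⊤ (_ , x′∈)) (≤-trans ⊤≤y y≤x))) x≉x′
        ... | no  ∁y≰⊥ with a , atom , a≤∁y ← atom-below (∁ˢ y) ∁y≰⊥ =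
          ℕ.≤-trans (atMostAbove-double atom (go y∨a (rs m∸r<m∸r)) xs xs! above)
            -- `2 ^ r + 2 ^ r` is `2 ^ suc r`, and `suc r` is at most the exponent for `y`.
            (ℕ.≤-trans (ℕ.≤-reflexive (cong (2 ^ r +_) (sym (ℕ.+-identityʳ (2 ^ r)))))
              (ℕ.^-monoʳ-≤ 2 m∸r<m∸r))
          where
          y∨a = y ∨ˢ (a , proj₁ atom)
          r   = m ∸ rank (proj₁ y∨a)

          y∨a≰y : ¬ proj₁ y∨a ≤ proj₁ y
          y∨a≰y y∨a≤y = ¬atom≤⊥ atom (≤-trans
            (∧-greatest (≤-trans (y≤x∨y _ _) y∨a≤y) a≤∁y)
            (reflexive (∧-complementʳ y)))

          m∸r<m∸r : r ℕ.< m ∸ rank (proj₁ y)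
          m∸r<m∸r = ℕ.∸-monoʳ-< (rank-strict _ _ (x≤x∨y _ _) y∨a≰y) (rank-bounded _)

      elements-above : ∀ {y} → (∀ (x : Element) → y ≤ proj₁ x) →
                       All (λ x → x ∈ˡ elements × y ≤ x) elements
      elements-above y≤ = All.tabulateₛ setoid λ x∈ → x∈ , y≤ (_ , x∈)

      size≤ : size ℕ.≤ 2 ^ (m ∸ rank ⊥)
      size≤ = atMostAbove-rank ⊥ˢ elements unique (elements-above ⊥≤x)

      module _ (large : 2 ^ m ℕ.≤ size) where

        private
          2^-cancel-≤ : ∀ {i j} → 2 ^ i ℕ.≤ 2 ^ j → i ℕ.≤ j
          2^-cancel-≤ {i} {j} le with i ℕ.≤? j
          ... | yes i≤j = i≤j
          ... | no  i≰j =
            contradiction (ℕ.<-≤-trans (ℕ.^-monoʳ-< 2 (s≤s (s≤s z≤n)) (ℕ.≰⇒> i≰j)) le) (ℕ.n≮n _)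

          cap : ∀ {r k} → r ℕ.≤ m → m ℕ.≤ k + (m ∸ r) → r ℕ.≤ k
          cap {r} {k} r≤m m≤ =
            ℕ.+-cancelʳ-≤ (m ∸ r) r k (ℕ.≤-trans (ℕ.≤-reflexive (ℕ.m+[n∸m]≡n r≤m)) m≤)

        -- Doubling the bound above `⊥ ∨ a` gives at most `2 ^ (1 + (m ∸ rank (⊥ ∨ a)))` elements in
        -- all. Since there are at least `2 ^ m`, the rank of `⊥ ∨ a`, and with it that of `a`, is
        -- at most 1.
        rank-atom : ∀ {a} → Atoms S a → rank a ℕ.≤ 1
        rank-atom {a} atom = ℕ.≤-trans (rank-mono _ _ (y≤x∨y ⊥ a)) (cap (rank-bounded (⊥ ∨ a))
          (2^-cancel-≤ (ℕ.≤-trans large (ℕ.≤-trans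
            (atMostAbove-double atom (atMostAbove-rank (⊥ˢ ∨ˢ (a , proj₁ atom)))
              elements unique (elements-above ⊥≤x))
            (ℕ.≤-reflexive (cong (k +_) (sym (ℕ.+-identityʳ k))))))))
          where k = 2 ^ (m ∸ rank (⊥ ∨ a))

-- Partitions as equivalence relations

comprehension : {P : Pred (Fin n) ℓ} → Unary.Decidable P → Subset n
comprehension P? = tabulate (does ∘ P?)

module _ {P : Pred (Fin n) ℓ} (P? : Unary.Decidable P) where

  ∈-comprehension⁺ : P x → x ∈ comprehension P?
  ∈-comprehension⁺ {x} px =
    lookup⇒[]= x _ (trans (lookup∘tabulate _ x) (dec-true (P? x) px))

  ∈-comprehension⁻ : x ∈ comprehension P? → P x
  ∈-comprehension⁻ {x} x∈ with P? x | trans (sym (lookup∘tabulate (does ∘ P?) x)) ([]=⇒lookup x∈)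
  ... | yes px | _ = px

-- The set grows from `⁅ x ⁆` by one `R`-successor at a time, so its complement shrinks. Since `P`
-- carries no decision procedure, `W` stands in for it wherever a `Subset` is required.
closed-subset : {R : Rel (Fin n) 0ℓ} → Binary.Decidable R → {P : Pred (Fin n) ℓ} →
                (∀ {y z} → P y → R y z → P z) → P x →
                ∃[ W ] (x ∈ W × (∀ {y} → y ∈ W → P y) × (∀ {y z} → y ∈ W → R y z → z ∈ W))
closed-subset {n} {x = x} {R} R? {P} closed px =
  go ⁅ x ⁆ (<-wellFounded _) (x∈⁅x⁆ x) λ y∈ → subst P (sym (x∈⁅y⁆⇒x≡y x y∈)) px
  where
  go : ∀ W → Acc ℕ._<_ (n ∸ ∣ W ∣) → x ∈ W → (∀ {y} → y ∈ W → P y) →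
       ∃[ W ] (x ∈ W × (∀ {y} → y ∈ W → P y) × (∀ {y z} → y ∈ W → R y z → z ∈ W))
  go W (acc rs) x∈W W⊆P
    with any? (λ y → any? λ z → (y ∈? W) ×-dec R? y z ×-dec ¬? (z ∈? W))
  ... | yes (y , z , y∈W , ryz , z∉W) =
    go (W ∪ ⁅ z ⁆) (rs (ℕ.∸-monoʳ-< (p⊂q⇒∣p∣<∣q∣ W⊂) (∣p∣≤n (W ∪ ⁅ z ⁆)))) (proj₁ W⊂ x∈W)
      λ {v} v∈ → [ W⊆P , (λ v∈z → subst P (sym (x∈⁅y⁆⇒x≡y z v∈z)) (closed (W⊆P y∈W) ryz)) ]′
                   (x∈p∪q⁻ W ⁅ z ⁆ v∈)
    where
    W⊂ : W ⊂ W ∪ ⁅ z ⁆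
    W⊂ = p⊆p∪q ⁅ z ⁆ , z , x∈p∪q⁺ (inj₂ (x∈⁅x⁆ z)) , z∉W
  ... | no ¬escape = W , x∈W , W⊆P , λ {y} {z} y∈W ryz → stays y z y∈W ryz
    where
    stays : ∀ y z → y ∈ W → R y z → z ∈ W
    stays y z y∈W ryz with z ∈? W
    ... | yes z∈W = z∈W
    ... | no  z∉W = contradiction (y , z , y∈W , ryz , z∉W) ¬escape

-- Membership in the chosen covering block is decidable, and this makes the order on partitions
-- decidable too.
Same : Partition n → Rel (Fin n) 0ℓ
Same π x y = y ∈ block π x

Same? : (π : Partition n) → Binary.Decidable (Same π)
Same? π x y = y ∈? block π x

module _ (π : Partition n) where

  Block⇒Same : ∀ {B} → Block π B → x ∈ B → y ∈ B → Same π x y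
  Block⇒Same {x} {y} πB x∈B y∈B =
    subst (y ∈_) (disjoint π πB (block-Block π x) x∈B (x∈block π x)) y∈B

  Block-resp-Same : ∀ {B} → Block π B → x ∈ B → Same π x y → y ∈ B
  Block-resp-Same {x} {y} πB x∈B x∼y =
    subst (y ∈_) (disjoint π (block-Block π x) πB (x∈block π x) x∈B) x∼y

  Same-refl : Same π x x
  Same-refl {x} = x∈block π x

  Same-sym : Same π x y → Same π y x
  Same-sym {x} x∼y = Block⇒Same (block-Block π x) x∼y (x∈block π x)

  Same-trans : Same π x y → Same π y z → Same π x z
  Same-trans {x} x∼y y∼z = Block-resp-Same (block-Block π x) x∼y y∼z

  Same-isEquivalence : IsEquivalence (Same π)
  Same-isEquivalence = record { refl = Same-refl ; sym = Same-sym ; trans = Same-trans }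

module _ (π σ : Partition n) where

  ≤ₚ⇒Same : π ≤ₚ σ → Same π ⇒ Same σ
  ≤ₚ⇒Same π≤σ {x} x∼y =
    let C , πC , x∈C , C⊆ = π≤σ (block-Block σ x) (x∈block σ x)
    in C⊆ (Block-resp-Same π πC x∈C x∼y)

  Same⇒≤ₚ : Same π ⇒ Same σ → π ≤ₚ σ
  Same⇒≤ₚ π⇒σ σB {x} x∈B =
    block π x , block-Block π x , x∈block π x , λ x∼y → Block-resp-Same σ σB x∈B (π⇒σ x∼y)

  ∧ₚ-Same⁺ : Same π x y → Same σ x y → Same (π ∧ₚ σ) x y
  ∧ₚ-Same⁺ p q = x∈p∩q⁺ (p , q)

  -- Closing `⁅ x ⁆` under both partitions inside `E x` gives a saturated set, which contains the
  -- component of `x` by `component-least`.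
  ∨ₚ-Same⁻ : {E : Rel (Fin n) ℓ} → Transitive E → Same π ⇒ E → Same σ ⇒ E → Same (π ∨ₚ σ) ⇒ E
  ∨ₚ-Same⁻ {E = E} E-trans π⇒E σ⇒E {x} x∼y =
    let W , x∈W , W⊆E , W-closed = closed-subset {R = λ y z → Same π y z ⊎ Same σ y z}
          (λ y z → Same? π y z ⊎-dec Same? σ y z) {P = E x}
          (λ exy yRz → E-trans exy ([ π⇒E , σ⇒E ]′ yRz)) (π⇒E (Same-refl π))
    in W⊆E (Join.component-least π σ
         ( (λ {y} y∈W → block π y , block-Block π y , x∈block π y , λ y∼z → W-closed y∈W (inj₁ y∼z))
         , (λ {y} y∈W → block σ y , block-Block σ y , x∈block σ y , λ y∼z → W-closed y∈W (inj₂ y∼z)))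
         x∈W x∼y)

_≤ₚ?_ : Binary.Decidable (_≤ₚ_ {n})
π ≤ₚ? σ = map′
  (λ f → Same⇒≤ₚ π σ λ {x} {y} → f x y)
  (λ π≤σ x y → ≤ₚ⇒Same π σ π≤σ)
  (all? λ x → all? λ y → Same? π x y →-dec Same? σ x y)

△-Same⁻ : Same {n} △ x y → x ≡ y
△-Same⁻ {x = x} x∼y = sym (x∈⁅y⁆⇒x≡y x x∼y)

-- The rank of a partition

module _ {m : ℕ} where

  -- i : Fin m stands for the point suc i, since zero is always minimal in its block.
  NonMinimal : Partition (suc m) → Pred (Fin m) 0ℓ
  NonMinimal π i = ∃[ u ] (u Fin.< suc i × Same π u (suc i))

  nonMinimal? : ∀ π → Unary.Decidable (NonMinimal π)
  nonMinimal? π i = any? λ u → (u Fin.<? suc i) ×-dec Same? π u (suc i)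

  nonMinimals : Partition (suc m) → Subset m
  nonMinimals π = comprehension (nonMinimal? π)

  rank : Partition (suc m) → ℕ
  rank π = ∣ nonMinimals π ∣

  rank≤m : ∀ π → rank π ℕ.≤ m
  rank≤m π = ∣p∣≤n (nonMinimals π)

  -- Strong induction on the larger of two points in one block of `σ`. The larger point is
  -- non-minimal for `σ`, hence for `π`, so `π` relates it to a smaller point `u`. Both `u` and the
  -- other point are smaller than it and lie in the same block of `σ`, so the induction hypothesis
  -- relates them in `π`.
  nonMinimals-reflect : ∀ π σ → π ≤ₚ σ → nonMinimals σ ⊆ nonMinimals π → σ ≤ₚ π
  nonMinimals-reflect π σ π≤σ Nσ⊆Nπ = Same⇒≤ₚ σ π λ {x} {y} x∼y →
    [ (λ x≤y → below y (Fin.<-wellFounded y) x x≤y x∼y)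
    , (λ y≤x → Same-sym π (below x (Fin.<-wellFounded x) y y≤x (Same-sym σ x∼y))) ]′ (Fin.≤-total x y)
    where
    below : ∀ y → Acc Fin._<_ y → ∀ x → x Fin.≤ y → Same σ x y → Same π x y
    below y (acc rs) x x≤y x∼y with x ≟ y
    below y       (acc rs) x x≤y x∼y | yes refl = Same-refl π
    below zero    (acc rs) x x≤y x∼y | no x≢y with () ← Fin.≤∧≢⇒< x≤y x≢y
    below (suc i) (acc rs) x x≤y x∼y | no x≢y
      with u , u<i , u∼i ← ∈-comprehension⁻ (nonMinimal? π)
             (Nσ⊆Nπ (∈-comprehension⁺ (nonMinimal? σ) (x , Fin.≤∧≢⇒< x≤y x≢y , x∼y)))
      with x∼u ← Same-trans σ x∼y (Same-sym σ (≤ₚ⇒Same π σ π≤σ u∼i))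
      with Fin.≤-total x u
    ... | inj₁ x≤u = Same-trans π (below u (rs u<i) x x≤u x∼u) u∼i
    ... | inj₂ u≤x =
      Same-trans π (Same-sym π (below x (rs (Fin.≤∧≢⇒< x≤y x≢y)) u u≤x (Same-sym σ x∼u))) u∼i

  nonMinimals-mono : ∀ π σ → π ≤ₚ σ → nonMinimals π ⊆ nonMinimals σ
  nonMinimals-mono π σ π≤σ i∈ =
    let u , u<i , u∼i = ∈-comprehension⁻ (nonMinimal? π) i∈
    in ∈-comprehension⁺ (nonMinimal? σ) (u , u<i , ≤ₚ⇒Same π σ π≤σ u∼i)

  rank-mono : ∀ π σ → π ≤ₚ σ → rank π ℕ.≤ rank σ
  rank-mono π σ π≤σ = p⊆q⇒∣p∣≤∣q∣ (nonMinimals-mono π σ π≤σ)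

  rank-strict : ∀ π σ → π ≤ₚ σ → ¬ σ ≤ₚ π → rank π ℕ.< rank σ
  rank-strict π σ π≤σ σ≰π with any? (λ i → (i ∈? nonMinimals σ) ×-dec ¬? (i ∈? nonMinimals π))
  ... | yes (i , i∈σ , i∉π) = p⊂q⇒∣p∣<∣q∣ (nonMinimals-mono π σ π≤σ , i , i∈σ , i∉π)
  ... | no ¬new = ⊥-elim (σ≰π (nonMinimals-reflect π σ π≤σ λ {i} → old i))
    where
    old : ∀ i → i ∈ nonMinimals σ → i ∈ nonMinimals π
    old i i∈σ with i ∈? nonMinimals π
    ... | yes i∈π = i∈π
    ... | no  i∉π = contradiction (i , i∈σ , i∉π) ¬new

  rank≡0⇒trivial : ∀ π → rank π ≡ 0 → Same π ⇒ _≡_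
  rank≡0⇒trivial π r≡0 x∼y =
    △-Same⁻ (≤ₚ⇒Same π △
      (nonMinimals-reflect △ π (BoundedLattice.minimum (Part _) π) λ {i} i∈ →
        contradiction (ℕ.<-≤-trans (x∈p⇒∣p-x∣<∣p∣ i∈) (ℕ.≤-reflexive r≡0)) ℕ.n≮0)
      x∼y)

  ∣p∣≤1⇒subsingleton : (p : Subset m) → ∣ p ∣ ℕ.≤ 1 → ∀ {i j} → i ∈ p → j ∈ p → i ≡ j
  ∣p∣≤1⇒subsingleton p ∣p∣≤1 {i} {j} i∈p j∈p with i ≟ j
  ... | yes i≡j = i≡j
  ... | no  i≢j = contradiction
    (ℕ.≤-<-trans z≤n (x∈p⇒∣p-x∣<∣p∣ (x∈p∧x≢y⇒x∈p-y i∈p i≢j)))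
    (ℕ.≤⇒≯ (ℕ.s≤s⁻¹ (ℕ.<-≤-trans (x∈p⇒∣p-x∣<∣p∣ j∈p) ∣p∣≤1)))

  -- The larger of two distinct related points is non-minimal, so it is the only non-minimal point,
  -- which serves as the hub.
  rank≤1⇒hub : ∀ π → rank π ℕ.≤ 1 → ∃[ h ] (∀ {x y} → Same π x y → x ≢ y → x ≡ h ⊎ y ≡ h)
  rank≤1⇒hub π r≤1 with nonempty? (nonMinimals π)
  ... | yes (i , i∈) = suc i , hub
    where
    top : ∀ {x y} → x Fin.< y → Same π x y → y ≡ suc i
    top {y = zero}  ()  _
    top {y = suc j} x<y x∼y = cong suc
      (∣p∣≤1⇒subsingleton (nonMinimals π) r≤1 (∈-comprehension⁺ (nonMinimal? π) (_ , x<y , x∼y)) i∈)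

    hub : ∀ {x y} → Same π x y → x ≢ y → x ≡ suc i ⊎ y ≡ suc i
    hub {x} {y} x∼y x≢y with Fin.<-cmp x y
    ... | tri< x<y _ _ = inj₂ (top x<y x∼y)
    ... | tri≈ _ x≡y _ = contradiction x≡y x≢y
    ... | tri> _ _ y<x = inj₁ (top y<x (Same-sym π x∼y))
  -- Without non-minimal points the partition is trivial, and any hub will do.
  ... | no empty = zero , λ x∼y x≢y → contradiction (rank≡0⇒trivial π r≡0 x∼y) x≢y
    where
    r≡0 : rank π ≡ 0
    r≡0 = trans (cong ∣_∣ (Empty-unique empty)) (Subset.∣⊥∣≡0 m)

-- The Boolean sublattice of a rooted tree

subsets : ∀ m → List (Subset m)
subsets zero = Vec.[] ∷ []
subsets (suc m) = cartesianProductWith Vec._∷_ (true ∷ false ∷ []) (subsets m)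

length-subsets : ∀ m → length (subsets m) ≡ 2 ^ m
length-subsets zero = refl
length-subsets (suc m) = trans (length-++ (map (true Vec.∷_) (subsets m)))
  (cong₂ _+_ (trans (length-map _ (subsets m)) (length-subsets m))
    (trans (length-++ (map (false Vec.∷_) (subsets m)))
      (cong₂ _+_ (trans (length-map _ (subsets m)) (length-subsets m)) refl)))

∈-subsets : ∀ {m} (S : Subset m) → S ∈ₗ subsets m
∈-subsets Vec.[] = here refl
∈-subsets (b Vec.∷ S) = ∈-cartesianProductWith⁺ Vec._∷_ (∈-bools b) (∈-subsets S)
  where
  ∈-bools : ∀ b → b ∈ₗ true ∷ false ∷ []
  ∈-bools true  = here refl
  ∈-bools false = there (here refl)

subsets-unique : ∀ m → Uniqueness.Unique (≡.setoid (Subset m)) (subsets m)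
subsets-unique zero = [] ∷ []
subsets-unique (suc m) = Unique≡.cartesianProductWith⁺ Vec._∷_ Vec.∷-injective
  (((λ ()) ∷ []) ∷ [] ∷ []) (subsets-unique m)

module _ {c ℓ₁ ℓ₂} (L : Lattice c ℓ₁ ℓ₂) where

  open Lattice L using (Carrier; _≈_; _∨_; _∧_; module Eq)

  -- The image of an embedding of the lattice of subsets is Boolean: both sides of each law
  -- involving distributivity or complements are values of `f` at equal subset expressions, which is
  -- what `≈-by` uses.
  module SubsetSublattice
    {m : ℕ} (f : Subset m → Carrier)
    (f-∪ : ∀ S T → f (S ∪ T) ≈ f S ∨ f T)
    (f-∩ : ∀ S T → f (S ∩ T) ≈ f S ∧ f T)
    (f-injective : ∀ {S T} → f S ≈ f T → S ≡ T)
    where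

    private
      open module Alg = IsLattice (Latticeₚ.isAlgLattice L) using (∨-cong; ∧-cong)
      module 𝔹 = BooleanAlgebra (∪-∩-booleanAlgebra m)
      open Membership (Lattice.setoid L) using () renaming (_∈_ to _∈ˡ_)

    f-cong : ∀ {S T} → S ≡ T → f S ≈ f T
    f-cong refl = Eq.refl

    image : List Carrier
    image = map f (subsets m)

    ∈-image⁺ : ∀ {x} S → x ≈ f S → x ∈ˡ image
    ∈-image⁺ S x≈fS = Any.map⁺ (Any.map (λ { refl → x≈fS }) (∈-subsets S))

    ∈-image⁻ : ∀ {x} → x ∈ˡ image → ∃[ S ] x ≈ f S
    ∈-image⁻ x∈ = Any.satisfied (Any.map⁻ x∈)

    ∨≈ : ∀ {x y S T} → x ≈ f S → y ≈ f T → x ∨ y ≈ f (S ∪ T)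
    ∨≈ x≈ y≈ = Eq.trans (∨-cong x≈ y≈) (Eq.sym (f-∪ _ _))

    ∧≈ : ∀ {x y S T} → x ≈ f S → y ≈ f T → x ∧ y ≈ f (S ∩ T)
    ∧≈ x≈ y≈ = Eq.trans (∧-cong x≈ y≈) (Eq.sym (f-∩ _ _))

    imageSublattice : Sublattice L
    imageSublattice = record
      { elements = image
      ; unique   = Unique.map⁺ (≡.setoid (Subset m)) (Lattice.setoid L) f-injective (subsets-unique m)
      ; ∨-closed = λ x∈ y∈ → let S , x≈ = ∈-image⁻ x∈ ; T , y≈ = ∈-image⁻ y∈
                                 in ∈-image⁺ (S ∪ T) (∨≈ x≈ y≈)
      ; ∧-closed = λ x∈ y∈ → let S , x≈ = ∈-image⁻ x∈ ; T , y≈ = ∈-image⁻ y∈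
                                 in ∈-image⁺ (S ∩ T) (∧≈ x≈ y≈)
      }

    open Sublattice imageSublattice using (Element; _∨ˢ_; _∧ˢ_)

    element : Subset m → Element
    element S = f S , ∈-image⁺ S Eq.refl

    preimage : Element → Subset m
    preimage (_ , x∈) = proj₁ (∈-image⁻ x∈)

    ≈-preimage : (x : Element) → proj₁ x ≈ f (preimage x)
    ≈-preimage (_ , x∈) = proj₂ (∈-image⁻ x∈)

    booleanSublattice : BooleanSublattice L
    booleanSublattice = record
      { sublattice = imageSublattice
      ; ∁ˢ = element ∘ ∁ ∘ preimage
      ; ⊤ˢ = element full
      ; ⊥ˢ = element none
      ; isBooleanAlgebra = record
        { isDistributiveLattice = record
          { isLattice = record
            { isEquivalence = record { refl = Eq.refl ; sym = Eq.sym ; trans = Eq.trans }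
            ; ∨-comm = λ x y → Alg.∨-comm _ _
            ; ∨-assoc = λ x y z → Alg.∨-assoc _ _ _
            ; ∨-cong = ∨-cong
            ; ∧-comm = λ x y → Alg.∧-comm _ _
            ; ∧-assoc = λ x y z → Alg.∧-assoc _ _ _
            ; ∧-cong = ∧-cong
            ; absorptive = (λ x y → Alg.∨-absorbs-∧ _ _) , (λ x y → Alg.∧-absorbs-∨ _ _)
            }
          ; ∨-distrib-∧ =
              (λ x y z → ≈-by (𝔹.∨-distribˡ-∧ _ _ _)
                (∨≈ (≈-preimage x) (∧≈ (≈-preimage y) (≈-preimage z)))
                (∧≈ (∨≈ (≈-preimage x) (≈-preimage y)) (∨≈ (≈-preimage x) (≈-preimage z))))
            , (λ x y z → ≈-by (𝔹.∨-distribʳ-∧ _ _ _)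
                (∨≈ (∧≈ (≈-preimage y) (≈-preimage z)) (≈-preimage x))
                (∧≈ (∨≈ (≈-preimage y) (≈-preimage x)) (∨≈ (≈-preimage z) (≈-preimage x))))
          ; ∧-distrib-∨ =
              (λ x y z → ≈-by (𝔹.∧-distribˡ-∨ _ _ _)
                (∧≈ (≈-preimage x) (∨≈ (≈-preimage y) (≈-preimage z)))
                (∨≈ (∧≈ (≈-preimage x) (≈-preimage y)) (∧≈ (≈-preimage x) (≈-preimage z))))
            , (λ x y z → ≈-by (𝔹.∧-distribʳ-∨ _ _ _)
                (∧≈ (∨≈ (≈-preimage y) (≈-preimage z)) (≈-preimage x))
                (∨≈ (∧≈ (≈-preimage y) (≈-preimage x)) (∧≈ (≈-preimage z) (≈-preimage x))))
          }
        ; ∨-complement =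
            (λ x → ≈-by (𝔹.∨-complementˡ _) (∨≈ Eq.refl (≈-preimage x)) Eq.refl)
          , (λ x → ≈-by (𝔹.∨-complementʳ _) (∨≈ (≈-preimage x) Eq.refl) Eq.refl)
        ; ∧-complement =
            (λ x → ≈-by (𝔹.∧-complementˡ _) (∧≈ Eq.refl (≈-preimage x)) Eq.refl)
          , (λ x → ≈-by (𝔹.∧-complementʳ _) (∧≈ (≈-preimage x) Eq.refl) Eq.refl)
        -- A preimage is read off a membership proof, so injectivity of `f` is what makes the
        -- preimages of equivalent elements agree.
        ; ¬-cong = λ {x} {y} x≈y → f-cong (cong ∁
            (f-injective (Eq.trans (Eq.sym (≈-preimage x)) (Eq.trans x≈y (≈-preimage y)))))
        }
      }
      where
      ≈-by : ∀ {x y S T} → S ≡ T → x ≈ f S → y ≈ f T → x ≈ y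
      ≈-by refl x≈ y≈ = Eq.trans x≈ (Eq.sym y≈)

    size-booleanSublattice : BooleanSublattice.size booleanSublattice ≡ 2 ^ m
    size-booleanSublattice = trans (length-map f (subsets m)) (length-subsets m)

module _ {n} (f : Fin n → Fin n) where

  -- Opaque so that x and y can be inferred from Same kernel x y.
  opaque
    fibre : Fin n → Subset n
    fibre x = comprehension (λ y → f x ≟ f y)

    kernel : Partition n
    kernel = record
      { Block    = λ B → ∃[ x ] B ≡ fibre x
      ; nonempty = λ { (x , refl) → x , ∈fibre refl }
      ; cover    = λ x → fibre x , (x , refl) , ∈fibre refl
      ; disjoint = λ { (y , refl) (z , refl) x∈y x∈z →
          ⊆-antisym (λ v∈ → ∈fibre (trans (fibre∋ x∈z) (trans (sym (fibre∋ x∈y)) (fibre∋ v∈))))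
                    (λ v∈ → ∈fibre (trans (fibre∋ x∈y) (trans (sym (fibre∋ x∈z)) (fibre∋ v∈)))) }
      }
      where
      ∈fibre : ∀ {x y} → f x ≡ f y → y ∈ fibre x
      ∈fibre {x} = ∈-comprehension⁺ (λ y → f x ≟ f y)
      fibre∋ : ∀ {x y} → y ∈ fibre x → f x ≡ f y
      fibre∋ {x} = ∈-comprehension⁻ (λ y → f x ≟ f y)

    kernel-Same⁺ : ∀ {x y} → f x ≡ f y → Same kernel x y
    kernel-Same⁺ {x} = ∈-comprehension⁺ (λ y → f x ≟ f y)

    kernel-Same⁻ : ∀ {x y} → Same kernel x y → f x ≡ f y
    kernel-Same⁻ {x} = ∈-comprehension⁻ (λ y → f x ≟ f y)

-- The root is `zero`. As `depth` drops along `parent`, every climb towards the root terminates.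
module RootedTree {m : ℕ} (parent : Fin m → Fin (suc m)) (depth : Fin (suc m) → ℕ)
                  (depth-parent : ∀ i → depth (parent i) ℕ.< depth (suc i)) where

  private
    variable
      S T : Subset m
      i : Fin m
      u v r s : Fin (suc m)

  -- Root S v r: r is the root of the tree of v when the edge from suc i to its parent is kept
  -- for i ∈ S only.
  data Root (S : Subset m) : Fin (suc m) → Fin (suc m) → Set where
    root : Root S zero zero
    cut  : i ∉ S → Root S (suc i) (suc i)
    up   : i ∈ S → Root S (parent i) r → Root S (suc i) r

  findRoot : ∀ S v → ∃ (Root S v)
  findRoot S v = go v (<-wellFounded _)
    where
    go : ∀ v → Acc ℕ._<_ (depth v) → ∃ (Root S v)
    go zero    _ = zero , root
    go (suc i) (acc rs) with i ∈? S
    ... | yes i∈S = let r , p = go (parent i) (rs (depth-parent i)) in r , up i∈S p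
    ... | no  i∉S = suc i , cut i∉S

  Root-unique : Root S v r → Root S v s → r ≡ s
  Root-unique root     root      = refl
  Root-unique (cut _)  (cut _)   = refl
  Root-unique (cut ∉S) (up ∈S _) = contradiction ∈S ∉S
  Root-unique (up ∈S _) (cut ∉S) = contradiction ∈S ∉S
  Root-unique (up _ p) (up _ q)  = Root-unique p q

  Root-depth : Root S v r → depth r ℕ.≤ depth v
  Root-depth root    = ℕ.≤-refl
  Root-depth (cut _) = ℕ.≤-refl
  Root-depth (up {i} _ p) = ℕ.≤-trans (Root-depth p) (ℕ.<⇒≤ (depth-parent i))

  forest : Subset m → Partition (suc m)
  forest S = kernel (λ v → proj₁ (findRoot S v))

  forest-Same⁺ : Root S u r → Root S v r → Same (forest S) u v
  forest-Same⁺ {S} p q = kernel-Same⁺ _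
    (trans (Root-unique (proj₂ (findRoot S _)) p) (Root-unique q (proj₂ (findRoot S _))))

  forest-Same⁻ : Same (forest S) u v → ∃[ r ] (Root S u r × Root S v r)
  forest-Same⁻ {S} {u} {v} u∼v =
    _ , proj₂ (findRoot S u) , subst (Root S v) (sym (kernel-Same⁻ _ u∼v)) (proj₂ (findRoot S v))

  forest-edge⁺ : i ∈ S → Same (forest S) (suc i) (parent i)
  forest-edge⁺ {i} {S} i∈S = let _ , p = findRoot S (parent i) in forest-Same⁺ (up i∈S p) p

  forest-edge⁻ : Same (forest S) (suc i) (parent i) → i ∈ S
  forest-edge⁻ {i = i} i∼ with forest-Same⁻ i∼
  ... | _ , up i∈S _ , _ = i∈S
  -- If the edge were cut, `suc i` would be the root of its own parent, which is less deep.
  ... | _ , cut _    , p = contradiction (Root-depth p) (ℕ.<⇒≱ (depth-parent i))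

  -- A chain of kept edges relates each vertex to its root, so the forest is the least equivalence
  -- containing the kept edges.
  forest-least : ∀ {ℓ} {E : Rel (Fin (suc m)) ℓ} → IsEquivalence E →
                 (∀ {i} → i ∈ S → E (suc i) (parent i)) → Same (forest S) ⇒ E
  forest-least {S} {E = E} E-equiv edge u∼v =
    let r , p , q = forest-Same⁻ u∼v in E.trans (toRoot p) (E.sym (toRoot q))
    where
    module E = IsEquivalence E-equiv
    toRoot : Root S v r → E v r
    toRoot root     = E.refl
    toRoot (cut _)  = E.refl
    toRoot (up i∈S p) = E.trans (edge i∈S) (toRoot p)

  forest-mono : S ⊆ T → forest S ≤ₚ forest T
  forest-mono {S} {T} S⊆T = Same⇒≤ₚ (forest S) (forest T)
    (forest-least (Same-isEquivalence (forest T)) (forest-edge⁺ ∘ S⊆T))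

  -- A root is strictly less deep than every other vertex of its tree, so `u` cannot be the root.
  deeper-nonroot : u ≢ v → depth v ℕ.≤ depth u → Root S u r → Root S v r →
                   ∃[ i ] (u ≡ suc i × i ∈ S × Root S (parent i) r)
  deeper-nonroot u≢v v≤u root     root     = contradiction refl u≢v
  deeper-nonroot u≢v v≤u (cut _)  (cut _)  = contradiction refl u≢v
  deeper-nonroot u≢v v≤u root (up {i} _ q) =
    contradiction (ℕ.≤-<-trans (Root-depth q) (depth-parent i)) (ℕ.≤⇒≯ v≤u)
  deeper-nonroot u≢v v≤u (cut _) (up {i} _ q) =
    contradiction (ℕ.≤-<-trans (Root-depth q) (depth-parent i)) (ℕ.≤⇒≯ v≤u)
  deeper-nonroot u≢v v≤u (up i∈S p) q = _ , refl , i∈S , p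

  -- The deeper of the two vertices is a root in neither forest, so its parent edge is kept by both
  -- `S` and `T`. Replacing it by its parent lowers the sum of the depths.
  forest-∩-Same : Same (forest S) u v → Same (forest T) u v → Same (forest (S ∩ T)) u v
  forest-∩-Same {S} {T = T} = go _ _ (<-wellFounded _)
    where
    step : ∀ {u v} → u ≢ v → depth v ℕ.≤ depth u → Same (forest S) u v → Same (forest T) u v →
           ∃[ i ] (u ≡ suc i × i ∈ S ∩ T × Same (forest S) (parent i) v × Same (forest T) (parent i) v)
    step u≢v v≤u u∼v u∼′v with forest-Same⁻ u∼v | forest-Same⁻ u∼′v
    ... | r , p , q | r′ , p′ , q′ with deeper-nonroot u≢v v≤u p q | deeper-nonroot u≢v v≤u p′ q′
    ... | i , refl , i∈S , pᵢ | .i , refl , i∈T , pᵢ′ =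
      i , refl , x∈p∩q⁺ (i∈S , i∈T) , forest-Same⁺ pᵢ q , forest-Same⁺ pᵢ′ q′

    go : ∀ u v → Acc ℕ._<_ (depth u + depth v) →
         Same (forest S) u v → Same (forest T) u v → Same (forest (S ∩ T)) u v
    go u v (acc rs) u∼v u∼′v with u ≟ v | ℕ.≤-total (depth v) (depth u)
    ... | yes refl | _ = Same-refl (forest (S ∩ T))
    ... | no u≢v | inj₁ v≤u with i , refl , i∈ , i∼v , i∼′v ← step u≢v v≤u u∼v u∼′v =
      Same-trans (forest (S ∩ T)) (forest-edge⁺ i∈)
        (go (parent i) v (rs (ℕ.+-monoˡ-< (depth v) (depth-parent i))) i∼v i∼′v)
    ... | no u≢v | inj₂ u≤v
      with i , refl , i∈ , i∼u , i∼′u ←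
             step (u≢v ∘ sym) u≤v (Same-sym (forest S) u∼v) (Same-sym (forest T) u∼′v) =
      Same-trans (forest (S ∩ T))
        (go u (parent i) (rs (ℕ.+-monoʳ-< (depth u) (depth-parent i)))
          (Same-sym (forest S) i∼u) (Same-sym (forest T) i∼′u))
        (Same-sym (forest (S ∩ T)) (forest-edge⁺ i∈))

  private
    open module P = BoundedLattice (Part (suc m)) using (_≈_; antisym)

  forest-∪ : ∀ S T → forest (S ∪ T) ≈ forest S ∨ₚ forest T
  forest-∪ S T = antisym {forest (S ∪ T)} {forest S ∨ₚ forest T}
    (Same⇒≤ₚ (forest (S ∪ T)) (forest S ∨ₚ forest T)
      (forest-least (Same-isEquivalence (forest S ∨ₚ forest T)) λ {i} i∈ →
        [ ≤ₚ⇒Same (forest S) (forest S ∨ₚ forest T) (P.x≤x∨y (forest S) (forest T)) ∘ forest-edge⁺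
        , ≤ₚ⇒Same (forest T) (forest S ∨ₚ forest T) (P.y≤x∨y (forest S) (forest T)) ∘ forest-edge⁺
        ]′ (x∈p∪q⁻ S T i∈)))
    (P.∨-least {forest S} {forest T} {forest (S ∪ T)}
      (forest-mono (p⊆p∪q T)) (forest-mono (q⊆p∪q S T)))

  forest-∩ : ∀ S T → forest (S ∩ T) ≈ forest S ∧ₚ forest T
  forest-∩ S T = antisym {forest (S ∩ T)} {forest S ∧ₚ forest T}
    (P.∧-greatest {forest (S ∩ T)} {forest S} {forest T}
      (forest-mono (p∩q⊆p S T)) (forest-mono (p∩q⊆q S T)))
    (Same⇒≤ₚ (forest S ∧ₚ forest T) (forest (S ∩ T)) λ u∼v → forest-∩-Same
      (≤ₚ⇒Same (forest S ∧ₚ forest T) (forest S) (P.x∧y≤x (forest S) (forest T)) u∼v)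
      (≤ₚ⇒Same (forest S ∧ₚ forest T) (forest T) (P.x∧y≤y (forest S) (forest T)) u∼v))

  forest-reflects : forest S ≤ₚ forest T → S ⊆ T
  forest-reflects {S} {T} S≤T i∈S =
    forest-edge⁻ (≤ₚ⇒Same (forest S) (forest T) S≤T (forest-edge⁺ i∈S))

  forest-injective : forest S ≈ forest T → S ≡ T
  forest-injective {S} {T} eq = ⊆-antisym
    (forest-reflects (P.reflexive {forest S} {forest T} eq))
    (forest-reflects (P.reflexive {forest T} {forest S} (P.Eq.sym {forest S} {forest T} eq)))

  open SubsetSublattice P.lattice forest forest-∪ forest-∩ forest-injective public

-- Simple paths and hypertrees

Link : Pred (Subset n) ℓ → Rel (Fin n) ℓ
Link E x y = ∃[ B ] (E B × x ∈ B × y ∈ B)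

Link-sym : {E : Pred (Subset n) ℓ} → Link E x y → Link E y x
Link-sym (B , EB , x∈B , y∈B) = B , EB , y∈B , x∈B

-- The index lists the vertices after the first one. An edge of the path contains no vertex of the
-- path after its target, which forces both the vertices and the edges to be distinct.
data SimplePath {n} (E : Pred (Subset n) ℓ) : Fin n → List (Fin n) → Fin n → Set ℓ where
  []   : SimplePath E x [] x
  step : E B → x ∈ B → y ∈ B → x ≢ y → SimplePath E y vs z → All (_∉ B) vs →
         SimplePath E x (y ∷ vs) z

module _ {n} {E : Pred (Subset n) ℓ} where

  -- Cutting at the last visit to B makes a detour through B simple.
  trim : ∀ B → SimplePath E y vs z →
         All (_∉ B) (y ∷ vs) ⊎ ∃[ r ] ∃[ us ] (r ∈ B × SimplePath E r us z × All (_∉ B) us)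
  trim {y = y} B [] with y ∈? B
  ... | yes y∈B = inj₂ (y , [] , y∈B , [] , [])
  ... | no  y∉B = inj₁ (y∉B ∷ [])
  trim {y = y} B w@(step _ _ _ _ w′ _) with trim B w′ | y ∈? B
  ... | inj₂ found | _       = inj₂ found
  ... | inj₁ fresh | yes y∈B = inj₂ (y , _ , y∈B , w , fresh)
  ... | inj₁ fresh | no  y∉B = inj₁ (y∉B ∷ fresh)

  -- Simplify the tail first, cut it at its last visit `r` to the first edge `B`, and go from `x` to
  -- `r` directly through `B`.
  simplify : Star (Link E) x z → ∃[ vs ] SimplePath E x vs z
  simplify ε = [] , []
  simplify {x = x} ((B , EB , x∈B , y∈B) ◅ ls) with trim B (proj₂ (simplify ls))
  ... | inj₁ (y∉B ∷ _) = contradiction y∈B y∉B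
  ... | inj₂ (r , us , r∈B , w , fresh) with x ≟ r
  ...   | yes refl = us , w
  ...   | no  x≢r  = r ∷ us , step EB x∈B r∈B x≢r w fresh

  target∈vertices : SimplePath E x vs z → z ∈ₗ x ∷ vs
  target∈vertices []               = here refl
  target∈vertices (step _ _ _ _ w _) = there (target∈vertices w)

  source-fresh : SimplePath E x vs z → All (x ≢_) vs
  source-fresh [] = []
  source-fresh (step {B = B} _ x∈B _ x≢y _ fresh) =
    x≢y ∷ All.map (λ v∉B x≡v → v∉B (subst (_∈ B) x≡v x∈B)) fresh

  edges : SimplePath E x vs z → Fin (length vs) → Subset n
  edges (step {B = B} _ _ _ _ _ _) zero    = B
  edges (step         _ _ _ _ w _) (suc i) = edges w i

  edges-E : (w : SimplePath E x vs z) → ∀ i → E (edges w i)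
  edges-E (step EB _ _ _ _ _) zero    = EB
  edges-E (step _  _ _ _ w _) (suc i) = edges-E w i

  source∈edges : (w : SimplePath E x vs z) → ∀ i → lookup (x ∷ vs) (inject₁ i) ∈ edges w i
  source∈edges (step _ x∈B _ _ _ _) zero    = x∈B
  source∈edges (step _ _   _ _ w _) (suc i) = source∈edges w i

  target∈edges : (w : SimplePath E x vs z) → ∀ i → lookup vs i ∈ edges w i
  target∈edges (step _ _ y∈B _ _ _) zero    = y∈B
  target∈edges (step _ _ _   _ w _) (suc i) = target∈edges w i

  edges-injective : (w : SimplePath E x vs z) → Injective _≡_ _≡_ (edges w)
  edges-injective (step _ _ _ _ w fresh) {zero}  {zero}  _  = refl
  edges-injective (step _ _ _ _ w fresh) {zero}  {suc j} eq =
    contradiction (subst (_ ∈_) (sym eq) (target∈edges w j)) (All.lookup fresh (∈-lookup j))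
  edges-injective w@(step _ _ _ _ _ _) {suc i} {zero} eq = sym (edges-injective w (sym eq))
  edges-injective (step _ _ _ _ w _) {suc i} {suc j} eq = cong suc (edges-injective w eq)

  vertices-injective : SimplePath E x vs z → Injective _≡_ _≡_ (lookup (x ∷ vs))
  vertices-injective w {zero} {zero} _ = refl
  vertices-injective w {zero} {suc j} eq = contradiction eq (All.lookup (source-fresh w) (∈-lookup j))
  vertices-injective w {suc i} {zero} eq = sym (vertices-injective w (sym eq))
  vertices-injective (step _ _ _ _ w _) {suc i} {suc j} eq = cong suc (vertices-injective w eq)

  lookup-last : SimplePath E x vs z → lookup (x ∷ vs) (fromℕ (length vs)) ≡ z
  lookup-last [] = refl
  lookup-last (step _ _ _ _ w _) = lookup-last w

_without_ : Pred (Subset n) ℓ → Subset n → Pred (Subset n) ℓ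
(E without B) C = E C × C ≢ B

module _ {n} {E : Pred (Subset n) ℓ} where

  -- Every edge of the path contains its target, which lies outside `B`.
  toStar-without : SimplePath E y vs z → All (_∉ B) vs → Star (Link (E without B)) y z
  toStar-without [] [] = ε
  toStar-without (step EC x∈C y∈C _ w _) (y∉B ∷ fresh) =
    (_ , (EC , λ C≡B → y∉B (subst (_ ∈_) C≡B y∈C)) , x∈C , y∈C) ◅ toStar-without w fresh

  -- Follows the path until it is about to use `B`; the vertex `v` reached then lies in `B`.
  until : ∀ B → SimplePath E y vs z →
          Star (Link (E without B)) y z ⊎
          ∃[ v ] (v ∈ₗ y ∷ vs × v ∈ B × Star (Link (E without B)) y v)
  until B [] = inj₁ ε
  until B (step {B = C} EC x∈C y∈C _ w _) with Vec.≡-dec Bool._≟_ C B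
  ... | yes refl = inj₂ (_ , here refl , x∈C , ε)
  ... | no  C≢B with until B w
  ...   | inj₁ ls                   = inj₁ ((C , (EC , C≢B) , x∈C , y∈C) ◅ ls)
  ...   | inj₂ (v , v∈ , v∈B , ls) = inj₂ (v , there v∈ , v∈B , (C , (EC , C≢B) , x∈C , y∈C) ◅ ls)

Star-map-fin : ∀ {a r} {A : Set a} {R : Rel A r} k (f : Fin (suc k) → A) →
               (∀ i → R (f (inject₁ i)) (f (suc i))) → Star R (f zero) (f (fromℕ k))
Star-map-fin zero  f r = ε
Star-map-fin (suc k) f r = r zero ◅ Star-map-fin k (f ∘ suc) (r ∘ suc)

-- Cycles and the uniqueness of simple paths

module _ {n} (H : Hypergraph n ℓ) where

  private E = Edge H

  Path⇒Star : ∀ {k} (p : Path H k) → Star (Link E) (Path.source p) (Path.target p)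
  Path⇒Star {k} p = Star-map-fin k (vertex p) λ i → edge p i , isEdge p i , source∈ p i , target∈ p i

  SimplePath⇒Path : SimplePath E x vs z →
                    ∃[ k ] ∃[ p ] (Path.source {H = H} {k} p ≡ x × Path.target p ≡ z)
  SimplePath⇒Path {x} {vs} w = length vs , record
    { vertex          = lookup (x ∷ vs)
    ; edge            = edges w
    ; isEdge          = edges-E w
    ; source∈         = source∈edges w
    ; target∈         = target∈edges w
    ; edges-distinct  = edges-injective w
    ; vertex-repeated = inj₁ ∘ vertices-injective w
    } , refl , lookup-last w

  Star⇒Connected : (∀ x y → Star (Link E) x y) → Connected H
  Star⇒Connected linked {x} {y} _ = SimplePath⇒Path (proj₂ (simplify (linked x y)))

  Linear : Set _
  Linear = ∀ {B C x y} → E B → E C → x ≢ y → x ∈ B → y ∈ B → x ∈ C → y ∈ C → B ≡ C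

  -- Put `B` in front of the path. It is a new edge because the path avoids it, and `z` recurs only
  -- at the end because the path visits no vertex twice.
  closeCycle : E B → z ∈ B → x ∈ B → SimplePath (E without B) x vs z → 2 ℕ.≤ length vs → Cycle H
  closeCycle {B = B} {z = z} {x = x} {vs = vs} EB z∈B x∈B w 2≤ = suc (length vs) , s≤s 2≤ , record
    { vertex          = vertex′
    ; edge            = edge′
    ; isEdge          = λ { zero → EB ; (suc i) → proj₁ (edges-E w i) }
    ; source∈         = λ { zero → z∈B ; (suc i) → source∈edges w i }
    ; target∈         = λ { zero → x∈B ; (suc i) → target∈edges w i }
    ; edges-distinct  = distinct
    ; vertex-repeated = repeated
    } , sym (lookup-last w)
    where
    vertex′ : Fin (suc (suc (length vs))) → Fin n
    vertex′ zero    = z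
    vertex′ (suc i) = lookup (x ∷ vs) i

    edge′ : Fin (suc (length vs)) → Subset n
    edge′ zero    = B
    edge′ (suc i) = edges w i

    distinct : Injective _≡_ _≡_ edge′
    distinct {zero}  {zero}  _  = refl
    distinct {zero}  {suc j} eq = contradiction (sym eq) (proj₂ (edges-E w j))
    distinct {suc i} {zero}  eq = contradiction eq (proj₂ (edges-E w i))
    distinct {suc i} {suc j} eq = cong suc (edges-injective w eq)

    repeated : ∀ {i j} → vertex′ i ≡ vertex′ j →
               i ≡ j ⊎ (i ≡ zero × j ≡ suc (fromℕ (length vs))) ⊎
               (i ≡ suc (fromℕ (length vs)) × j ≡ zero)
    repeated {zero}  {zero}  _  = inj₁ refl
    repeated {zero}  {suc j} eq =
      inj₂ (inj₁ (refl , cong suc (vertices-injective w (trans (sym eq) (sym (lookup-last w))))))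
    repeated {suc i} {zero}  eq =
      inj₂ (inj₂ (cong suc (vertices-injective w (trans eq (sym (lookup-last w)))) , refl))
    repeated {suc i} {suc j} eq = inj₁ (cong suc (vertices-injective w eq))

  module Acyclic (linear : Linear) (acyclic : ¬ Cycle H) where

    -- Simplify the walk. A single edge would share two vertices with `B` and so equal it by
    -- linearity; two or more edges close up with `B` to a cycle.
    no-detour : E B → x ∈ B → y ∈ B → x ≢ y → ¬ Star (Link (E without B)) x y
    no-detour EB x∈B y∈B x≢y ls with simplify ls
    ... | _ , [] = x≢y refl
    ... | _ , step (EC , C≢B) x∈C y∈C _ [] _ = C≢B (linear EC EB x≢y x∈C y∈C x∈B y∈B)
    ... | _ , w@(step _ _ _ _ (step _ _ _ _ _ _) _) =
      acyclic (closeCycle EB y∈B x∈B w (s≤s (s≤s z≤n)))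

    -- At the first divergence there is a detour around the first edge `B`. If the paths leave `B`
    -- at different vertices, their tails form it. If the second path starts with another edge, it
    -- either returns to `B` at some `v` other than `x`, or avoids `B` altogether and continues
    -- backwards along the tail of the first path.
    SimplePath-unique : SimplePath E x vs z → SimplePath E x us z → vs ≡ us
    SimplePath-unique [] [] = refl
    SimplePath-unique [] w@(step _ _ _ _ w′ _) =
      contradiction refl (All.lookup (source-fresh w) (target∈vertices w′))
    SimplePath-unique w@(step _ _ _ _ w′ _) [] =
      contradiction refl (All.lookup (source-fresh w) (target∈vertices w′))
    SimplePath-unique {x = x} (step {B = B} {y = y} EB x∈B y∈B x≢y w fresh)
                      w₂@(step {B = C} {y = y′} EC x∈C y′∈C _ w′ fresh′)
      with Vec.≡-dec Bool._≟_ C B | y ≟ y′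
    ... | yes refl | yes refl = cong (y ∷_) (SimplePath-unique w w′)
    ... | yes refl | no  y≢y′ = contradiction
      (toStar-without w fresh ◅◅ reverse Link-sym (toStar-without w′ fresh′))
      (no-detour EB y∈B y′∈C y≢y′)
    ... | no C≢B | _ with until B w′
    ...   | inj₁ ls = contradiction
      (((C , (EC , C≢B) , x∈C , y′∈C) ◅ ls) ◅◅ reverse Link-sym (toStar-without w fresh))
      (no-detour EB x∈B y∈B x≢y)
    ...   | inj₂ (v , v∈ , v∈B , ls) = contradiction
      ((C , (EC , C≢B) , x∈C , y′∈C) ◅ ls)
      (no-detour EB x∈B v∈B (All.lookup (source-fresh w₂) v∈))

-- Rooting a hypertree

module ParentFunction
  {m} (H : Hypergraph (suc m) ℓ) (linear : Linear H) (hypertree : IsHypertree H) where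

  open Acyclic H linear (proj₂ hypertree)

  private
    E = Edge H

    firstOrZero : List (Fin (suc m)) → Fin (suc m)
    -- This default is not reached by `parent`, since a path from `suc i` to `zero` has a first
    -- step.
    firstOrZero []      = zero
    firstOrZero (v ∷ _) = v

  toZero : ∀ v → ∃[ vs ] SimplePath E v vs zero
  toZero v with v ≟ zero
  ... | yes refl = [] , []
  ... | no  v≢0  with _ , p , refl , p0 ← proj₁ hypertree v≢0 =
    simplify (subst (Star (Link E) _) p0 (Path⇒Star H p))

  depth : Fin (suc m) → ℕ
  depth v = length (proj₁ (toZero v))

  parent : Fin m → Fin (suc m)
  parent i = firstOrZero (proj₁ (toZero (suc i)))

  depth-SimplePath : SimplePath E x vs zero → depth x ≡ length vs
  depth-SimplePath w = cong length (SimplePath-unique (proj₂ (toZero _)) w)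

  parent-SimplePath : ∀ {i} → SimplePath E (suc i) (x ∷ vs) zero → parent i ≡ x
  parent-SimplePath w = cong firstOrZero (SimplePath-unique (proj₂ (toZero _)) w)

  depth-parent : ∀ i → depth (parent i) ℕ.< depth (suc i)
  depth-parent i with toZero (suc i)
  ... | _ ∷ _ , step _ _ _ _ w _ = s≤s (ℕ.≤-reflexive (depth-SimplePath w))

  -- Take for `r` the last vertex in `B` on the path from `x` to `zero`. From any other vertex of
  -- `B`, one step through `B` to `r` followed by the rest of that path is simple, so by uniqueness
  -- it determines the parent.
  edge-root : E B → x ∈ B →
              ∃[ r ] (r ∈ B × (∀ {v} → v ∈ B → v ≢ r → ∃[ i ] (v ≡ suc i × parent i ≡ r)))
  edge-root {B = B} {x = x} EB x∈B with trim B (proj₂ (toZero x))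
  ... | inj₁ (x∉B ∷ _) = contradiction x∈B x∉B
  ... | inj₂ (r , us , r∈B , w , fresh) = r , r∈B , λ
    -- If `zero` lies in `B`, it is `r`: otherwise there would be a nonempty simple path from `zero`
    -- to itself.
    { {zero}  0∈B 0≢r → contradiction (SimplePath-unique [] (step EB 0∈B r∈B 0≢r w fresh)) λ ()
    ; {suc i} i∈B i≢r → i , refl , parent-SimplePath (step EB i∈B r∈B i≢r w fresh)
    }

-- Boolean sublattices of the partition lattice

module _ {m : ℕ} where

  private
    module P = BoundedLattice (Part (suc m))

  open BooleanSublatticeProperties P.lattice _≤ₚ?_ rank
    rank-mono rank-strict rank≤m

  Same⊆-isIdeal : ∀ {ℓ} {E : Rel (Fin (suc m)) ℓ} → Transitive E → IsIdeal (λ π → Same π ⇒ E)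
  Same⊆-isIdeal E-trans = record
    { downward = λ {π} {σ} π≤σ σ⇒E x∼y → σ⇒E (≤ₚ⇒Same π σ π≤σ x∼y)
    ; directed = λ {π} {σ} π⇒E σ⇒E → ∨ₚ-Same⁻ π σ E-trans π⇒E σ⇒E
    }

  -- `Same π ⇒ Within B` expresses that every non-singleton block of `π` is contained in `B`.
  Within : Subset (suc m) → Rel (Fin (suc m)) _
  Within B x y = x ≡ y ⊎ (x ∈ B × y ∈ B)

  within? : ∀ B → Binary.Decidable (Within B)
  within? B x y = (x ≟ y) ⊎-dec ((x ∈? B) ×-dec (y ∈? B))

  within-trans : ∀ {B} → Transitive (Within B)
  within-trans (inj₁ refl)      q                = q
  within-trans p@(inj₂ _)       (inj₁ refl)      = p
  within-trans (inj₂ (x∈B , _)) (inj₂ (_ , z∈B)) = inj₂ (x∈B , z∈B)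

  module _ (𝓑 : PartSublattice (suc m)) (△∈𝓑 : △ ∈ˢ 𝓑) where

    open BooleanSublattice 𝓑 using (Element)

    ⊥⇒≡ : Same (⊥ 𝓑) ⇒ _≡_
    ⊥⇒≡ x∼y = △-Same⁻ (≤ₚ⇒Same (⊥ 𝓑) △ (⊥≤x 𝓑 (△ , △∈𝓑)) x∼y)

    atoms-generate-Same : ∀ {ℓ} {E : Rel (Fin (suc m)) ℓ} → Reflexive E → Transitive E →
                          (b : Element) → (∀ {a} → Atoms 𝓑 a → a ≤ₚ proj₁ b → Same a ⇒ E) → Same (proj₁ b) ⇒ E
    atoms-generate-Same {E = E} E-refl E-trans b atoms⇒E =
      atoms-generate 𝓑 (Same⊆-isIdeal E-trans)
        (λ x∼y → subst (E _) (⊥⇒≡ x∼y) E-refl) b (λ {a} → atoms⇒E {a})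

    atom-edge : ∀ a {x y} → Atoms 𝓑 a → Same a x y → x ≢ y → Edge (𝓗 (Atoms 𝓑)) (block a x)
    atom-edge a {x} atom x∼y x≢y =
      (λ v eq → x≢y (trans (x∈⁅y⁆⇒x≡y v (subst (x ∈_) eq (x∈block a x)))
                           (sym (x∈⁅y⁆⇒x≡y v (subst (_ ∈_) eq x∼y))))) ,
      a , atom , block-Block a x

    -- Two atoms are either equal, and then blocks with a common point coincide, or have trivial
    -- meet, and then their blocks cannot share two points.
    𝓗-linear : Linear (𝓗 (Atoms 𝓑))
    𝓗-linear (_ , π , πatom , πB) (_ , σ , σatom , σC) x≢y x∈B y∈B x∈C y∈C
      with atom≤⊎∧≤⊥ 𝓑 {π} πatom (σ , proj₁ σatom)
    ... | inj₂ σ∧π≤⊥ = contradiction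
      (⊥⇒≡ (≤ₚ⇒Same (σ ∧ₚ π) (⊥ 𝓑) σ∧π≤⊥
        (∧ₚ-Same⁺ σ π (Block⇒Same σ σC x∈C y∈C) (Block⇒Same π πB x∈B y∈B)))) x≢y
    ... | inj₁ π≤σ with proj₂ (proj₂ σatom) {π} (proj₁ πatom) π≤σ
    ...   | inj₁ π≈⊥       = contradiction π≈⊥ (proj₁ (proj₂ πatom))
    ...   | inj₂ (π⊆σ , _) = disjoint σ (π⊆σ πB) σC x∈B x∈C

    -- The atoms generate `∇`, and each of them relates only points that are linked by at most one
    -- hyperedge.
    𝓗-connected : ∇ ∈ˢ 𝓑 → Connected (𝓗 (Atoms 𝓑))
    𝓗-connected ∇∈𝓑 = Star⇒Connected (𝓗 (Atoms 𝓑)) λ x y →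
      atoms-generate-Same ε _◅◅_ (∇ , ∇∈𝓑) (λ {a} → linked {a}) (∈⊤ {x = y})
      where
      linked : ∀ {a} → Atoms 𝓑 a → a ≤ₚ ∇ → Same a ⇒ Star (Link (Edge (𝓗 (Atoms 𝓑))))
      linked {a} atom _ {x} {y} x∼y with x ≟ y
      ... | yes refl = ε
      ... | no  x≢y  = (block a x , atom-edge a atom x∼y x≢y , x∈block a x , x∼y) ◅ ε

  size≤2^m : (T : PartSublattice (suc m)) → BooleanSublattice.size T ℕ.≤ 2 ^ m
  size≤2^m T = ℕ.≤-trans (size≤ T) (ℕ.^-monoʳ-≤ 2 (ℕ.m∸n≤m m (rank (⊥ T))))

  hypertree⇒extension : (𝓑 : PartSublattice (suc m)) → △ ∈ˢ 𝓑 → IsHypertree (𝓗 (Atoms 𝓑)) →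
                        ∃[ 𝓒 ] (𝓑 ⊆ˢ 𝓒 × Largest 𝓒)
  hypertree⇒extension 𝓑 △∈𝓑 hypertree = T.booleanSublattice , (λ {b} → 𝓑⊆𝓒 {b}) ,
    λ S → ℕ.≤-trans (size≤2^m S) (ℕ.≤-reflexive (sym T.size-booleanSublattice))
    where
    open ParentFunction (𝓗 (Atoms 𝓑)) (𝓗-linear 𝓑 △∈𝓑) hypertree
    module T = RootedTree parent depth depth-parent

    𝓑⊆𝓒 : 𝓑 ⊆ˢ T.booleanSublattice
    𝓑⊆𝓒 {b} b∈𝓑 = T.∈-image⁺ {b} S (P.antisym {b} {T.forest S} b≤forest forest≤b)
      where
      -- By `forest-edge⁺` and `forest-edge⁻`, this is the only set of tree edges whose forest can
      -- be `b`.
      kept? = λ i → Same? b (suc i) (parent i)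
      S = comprehension kept?

      forest≤b : T.forest S ≤ₚ b
      forest≤b = Same⇒≤ₚ (T.forest S) b
        (T.forest-least (Same-isEquivalence b) (∈-comprehension⁻ kept?))

      atom⇒forest : ∀ {a} → Atoms 𝓑 a → a ≤ₚ b → Same a ⇒ Same (T.forest S)
      atom⇒forest {a} atom a≤b {x} {y} x∼y with x ≟ y
      ... | yes refl = Same-refl (T.forest S)
      ... | no x≢y
        with r , r∈B , toRoot ← edge-root (atom-edge 𝓑 △∈𝓑 a atom x∼y x≢y) (x∈block a x) =
        Same-trans (T.forest S) (∼r (x∈block a x)) (Same-sym (T.forest S) (∼r x∼y))
        where
        ∼r : ∀ {v} → v ∈ block a x → Same (T.forest S) v r
        ∼r {v} v∈B with v ≟ r
        ... | yes refl = Same-refl (T.forest S)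
        ... | no v≢r with i , refl , refl ← toRoot v∈B v≢r =
          T.forest-edge⁺ (∈-comprehension⁺ kept?
            (≤ₚ⇒Same a b a≤b (Block⇒Same a (block-Block a x) v∈B r∈B)))

      b≤forest : b ≤ₚ T.forest S
      b≤forest = Same⇒≤ₚ b (T.forest S) (atoms-generate-Same 𝓑 △∈𝓑
        (Same-refl (T.forest S)) (Same-trans (T.forest S)) (b , b∈𝓑) (λ {a} → atom⇒forest {a}))

  -- Compare with the sublattice of the star in which every other vertex is a child of `zero`.
  Largest⇒2^m≤size : (𝓒 : PartSublattice (suc m)) → Largest 𝓒 → 2 ^ m ℕ.≤ BooleanSublattice.size 𝓒
  Largest⇒2^m≤size 𝓒 largest =
    ℕ.≤-trans (ℕ.≤-reflexive (sym T.size-booleanSublattice)) (largest T.booleanSublattice)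
    where
    depth : Fin (suc m) → ℕ
    depth zero    = 0
    depth (suc _) = 1
    module T = RootedTree {m} (λ _ → zero) depth (λ _ → s≤s z≤n)

  -- One of `x` and `y` is the hub, so the hub lies in `B`. Every nontrivial pair contains the hub,
  -- and `spread` brings its other point into `B`.
  within-of-hub : (a : Partition (suc m)) →
                  ∃[ h ] (∀ {u v} → Same a u v → u ≢ v → u ≡ h ⊎ v ≡ h) →
                  ∀ {B} → (∀ {u v} → Same a u v → u ∈ B → v ∈ B) →
                  ∀ {x y} → Same a x y → x ≢ y → x ∈ B → Same a ⇒ Within B
  within-of-hub a (h , hub) {B} spread x∼y x≢y x∈B {u} {v} u∼v with u ≟ v
  ... | yes u≡v = inj₁ u≡v
  ... | no  u≢v = inj₂ ([ (λ { refl → h∈B , spread u∼v h∈B })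
                        , (λ { refl → spread (Same-sym a u∼v) h∈B , h∈B }) ]′ (hub u∼v u≢v))
    where
    h∈B : h ∈ B
    h∈B = [ (λ { refl → x∈B }) , (λ { refl → spread x∼y x∈B }) ]′ (hub x∼y x≢y)

  -- Acyclicity from a largest extension

  module _ (𝓒 : PartSublattice (suc m)) (△∈𝓒 : △ ∈ˢ 𝓒) (largest : Largest 𝓒) where

    open BooleanSublattice 𝓒 using (Element; ∁ˢ; isBooleanAlgebra)
    open IsBooleanAlgebra isBooleanAlgebra using (∧-complementʳ)

    -- The atoms of `𝓒` below `b` generate it. As they have rank at most 1, each one that relates
    -- distinct points of `B` lies entirely within `B`, hence below `c`.
    atoms-span-block : (b : Element) (c : Partition (suc m)) → ∀ {B} → Block (proj₁ b) B →
                       (∀ {a} → Atoms 𝓒 a → Same a ⇒ Within B → a ≤ₚ c) →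
                       ∀ {x y} → x ∈ B → y ∈ B → Same c x y
    atoms-span-block (b , b∈) c {B} bB inside≤c x∈B y∈B =
      proj₂ (atoms-generate-Same 𝓒 △∈𝓒 {E = E}
        (λ x∈B → x∈B , Same-refl c)
        (λ xEy yEz x∈B → let y∈B , x∼y = xEy x∈B ; z∈B , y∼z = yEz y∈B in
          z∈B , Same-trans c x∼y y∼z)
        (b , b∈) (λ {a} → atom⇒E {a}) (Block⇒Same b bB x∈B y∈B) x∈B)
      where
      E : Rel (Fin (suc m)) _
      -- Pairs that start outside `B` satisfy this vacuously, so only the atoms that act on `B`
      -- matter.
      E x y = x ∈ B → y ∈ B × Same c x y

      atom⇒E : ∀ {a} → Atoms 𝓒 a → a ≤ₚ b → Same a ⇒ E
      atom⇒E {a} atom a≤b {x} {y} x∼y x∈B with x ≟ y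
      ... | yes refl = x∈B , Same-refl c
      ... | no  x≢y  = spread x∼y x∈B , ≤ₚ⇒Same a c (inside≤c {a} atom
        (within-of-hub a (rank≤1⇒hub a (rank-atom 𝓒 (Largest⇒2^m≤size 𝓒 largest) {a} atom))
          spread x∼y x≢y x∈B)) x∼y
        where
        spread : ∀ {u v} → Same a u v → u ∈ B → v ∈ B
        spread u∼v u∈B = Block-resp-Same b bB u∈B (≤ₚ⇒Same a b a≤b u∼v)

    𝓗-acyclic : (𝓑 : PartSublattice (suc m)) → △ ∈ˢ 𝓑 → 𝓑 ⊆ˢ 𝓒 → ¬ Cycle (𝓗 (Atoms 𝓑))
    𝓗-acyclic 𝓑 △∈𝓑 𝓑⊆𝓒 (suc (suc k) , _ , cyc , closed) =
      let pˢ , p⇒B₀ , greatest = principal 𝓒 (Same⊆-isIdeal (within-trans {B₀}))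
            (λ π → map′ (λ f {x} {y} → f x y) (λ f x y → f)
              (all? λ x → all? λ y → Same? π x y →-dec within? B₀ x y))
            (λ x∼y → inj₁ (⊥⇒≡ 𝓒 △∈𝓒 x∼y))
      in v₀≢v₁ (collapse pˢ p⇒B₀ greatest)
      where
      B₀ = edge cyc zero

      v₀≢v₁ : vertex cyc zero ≢ vertex cyc (suc zero)
      v₀≢v₁ eq with vertex-repeated cyc eq
      ... | inj₁ ()
      ... | inj₂ (inj₁ (_ , ()))
      ... | inj₂ (inj₂ (() , _))

      -- Edge `i` is a block of an atom of `𝓑`, which is an element of `𝓒` but possibly not one of
      -- its atoms.
      spanned : ∀ i (c : Partition (suc m)) →
                (∀ {a} → Atoms 𝓒 a → Same a ⇒ Within (edge cyc i) → a ≤ₚ c) →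
                Same c (vertex cyc (inject₁ i)) (vertex cyc (suc i))
      spanned i c inside≤c with isEdge cyc i
      ... | _ , b , atom , bB = atoms-span-block (b , 𝓑⊆𝓒 {b} (proj₁ atom)) c bB
        (λ {a} → inside≤c {a}) (source∈ cyc i) (target∈ cyc i)

      -- By linearity two common points would make this edge equal to `B₀`, contradicting the
      -- distinctness of the edges of the cycle.
      within-both : ∀ i {u v} → Within (edge cyc (suc i)) u v → Within B₀ u v → u ≡ v
      within-both i (inj₁ u≡v) _          = u≡v
      within-both i (inj₂ _)   (inj₁ u≡v) = u≡v
      within-both i {u} {v} (inj₂ (u∈ , v∈)) (inj₂ (u∈₀ , v∈₀)) with u ≟ v
      ... | yes u≡v = u≡v
      ... | no  u≢v with () ← edges-distinct cyc
        (𝓗-linear 𝓑 △∈𝓑 (isEdge cyc (suc i)) (isEdge cyc zero) u≢v u∈ v∈ u∈₀ v∈₀)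

      collapse : (pˢ : Element) → Same (proj₁ pˢ) ⇒ Within B₀ →
                 ((x : Element) → Same (proj₁ x) ⇒ Within B₀ → proj₁ x ≤ₚ proj₁ pˢ) →
                 vertex cyc zero ≡ vertex cyc (suc zero)
      collapse pˢ p⇒B₀ greatest =
        ⊥⇒≡ 𝓒 △∈𝓒 (≤ₚ⇒Same (p ∧ₚ q) (⊥ 𝓒)
          (P.reflexive {p ∧ₚ q} {⊥ 𝓒} (∧-complementʳ pˢ)) (∧ₚ-Same⁺ p q v₀∼v₁ v₀∼′v₁))
        where
        p = proj₁ pˢ
        q = proj₁ (∁ˢ pˢ)

        v₀∼v₁ : Same p (vertex cyc zero) (vertex cyc (suc zero))
        v₀∼v₁ = spanned zero p λ {a} atom a⇒B₀ → greatest (a , proj₁ atom) a⇒B₀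

        -- An atom below `p` has its non-singleton blocks inside `B₀` as well as inside edge
        -- `suc i`, so it relates only equal points and lies below `q` too.
        outside : ∀ i a → Same a ⇒ Within (edge cyc (suc i)) → a ≤ₚ p ⊎ a ≤ₚ q → a ≤ₚ q
        outside i a a⇒Bᵢ (inj₁ a≤p) = Same⇒≤ₚ a q λ {u} u∼v →
          subst (Same q u) (within-both i (a⇒Bᵢ u∼v) (p⇒B₀ (≤ₚ⇒Same a p a≤p u∼v))) (Same-refl q)
        outside i a a⇒Bᵢ (inj₂ a≤q) = a≤q

        around : ∀ i → Same q (vertex cyc (suc (inject₁ i))) (vertex cyc (suc (suc i)))
        around i = spanned (suc i) q λ {a} atom a⇒Bᵢ → outside i a a⇒Bᵢ (atom≤⊎≤∁ 𝓒 {a} atom pˢ)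

        v₀∼′v₁ : Same q (vertex cyc zero) (vertex cyc (suc zero))
        -- Go around the cycle from vertex 1 to the last vertex, which is vertex 0 by `closed`.
        v₀∼′v₁ = Same-sym q (subst (Same q (vertex cyc (suc zero))) (sym closed)
          (fold (Same q) (Same-trans q) (Same-refl q)
            (Star-map-fin (suc k) (vertex cyc ∘ suc) around)))
    𝓗-acyclic _ _ _ (0 , () , _)
    𝓗-acyclic _ _ _ (1 , s≤s () , _)

theorem4p4 : ∀ (n : ℕ) .{{_ : NonZero n}} (𝓑 : PartSublattice n) → △ ∈ˢ 𝓑 → ∇ ∈ˢ 𝓑 →
    (∃[ 𝓒 ] (𝓑 ⊆ˢ 𝓒 × Largest 𝓒)) ⇔ IsHypertree (𝓗 (Atoms 𝓑))
theorem4p4 zero 𝓑 _ _ = contradiction refl (≢-nonZero⁻¹ 0)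
theorem4p4 (suc m) 𝓑 △∈𝓑 ∇∈𝓑 = mk⇔
  (λ (𝓒 , 𝓑⊆𝓒 , largest) →
    𝓗-connected 𝓑 △∈𝓑 ∇∈𝓑 , 𝓗-acyclic 𝓒 (𝓑⊆𝓒 {△} △∈𝓑) largest 𝓑 △∈𝓑 (λ {b} → 𝓑⊆𝓒 {b}))
  (hypertree⇒extension 𝓑 △∈𝓑)
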